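{- For all sufficiently large $n$, $$0.596400\, n^2 < t(K_n) < 0.637152\, n^2,$$ where $K_n$ is the complete graph on $n$ vertices and $t(\cdot)$ denotes the toppling number.
   Context: All graphs are finite, simple and undirected. A configuration of a graph $G$ is a function $c: V(G)\to \mathbb{N}\cup\{0\}$ giving the number of chips on each vertex. A vertex $v$ may be fired if $c(v)\ge \deg(v)$; firing $v$ removes $\deg(v)$ chips from $v$ and adds one chip to each neighbour of $v$. A configuration is volatile if there is an infinite sequence $v_1,v_2,\dots$ of vertices that may be fired in that order. The toppling game on $G$: initially there are no chips; two players, Max and Min, alternately place one chip on a vertex of their choice (Max moves first). After each move vertices are fired as possible, and the game ends as soon as a volatile configuration is reached. Max aims to maximize and Min to minimize the number of chips placed during the game. The toppling number $t(G)$ is the length (number of chips placed) of the game when Max starts and both play optimally. -}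

module Defs where

open import Data.Nat using (ℕ; zero; suc; _+_; _*_; _∸_; _≤_; _<_)
open import Data.Bool using (Bool; true; false; not; if_then_else_)
open import Data.Fin using (Fin; _≟_)
open import Data.List using (List; map; allFin)
open import Data.Nat.ListAction using (sum)
open import Data.Product using (Σ; ∃; _×_; _,_)
open import Relation.Nullary using (¬_)
open import Relation.Nullary.Decidable using (⌊_⌋)
open import Relation.Binary.PropositionalEquality using (_≡_)

record Graph : Set where
  field
    n     : ℕ
    adj   : Fin n → Fin n → Bool
    sym   : ∀ u v → adj u v ≡ adj v u
    irrefl : ∀ v → adj v v ≡ false

K : ℕ → Graph
K m = record
  { n = m
  ; adj = λ u v → not ⌊ u ≟ v ⌋
  ; sym = symK
  ; irrefl = irrK }
  where
  open import Relation.Binary.PropositionalEquality using (refl; sym)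
  open import Relation.Nullary using (yes; no)
  symK : ∀ u v → not ⌊ u ≟ v ⌋ ≡ not ⌊ v ≟ u ⌋
  symK u v with u ≟ v | v ≟ u
  ... | yes _ | yes _ = refl
  ... | no _  | no _  = refl
  ... | yes p | no q  = Data.Empty.⊥-elim (q (sym p)) where import Data.Empty
  ... | no p  | yes q = Data.Empty.⊥-elim (p (sym q)) where import Data.Empty
  irrK : ∀ v → not ⌊ v ≟ v ⌋ ≡ false
  irrK v with v ≟ v
  ... | yes _ = refl
  ... | no ¬p = Data.Empty.⊥-elim (¬p refl) where import Data.Empty

module Toppling (G : Graph) where
  open Graph G

  b2n : Bool → ℕ
  b2n b = if b then 1 else 0

  deg : Fin n → ℕ
  deg v = sum (map (λ w → b2n (adj v w)) (allFin n))

  Config : Set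
  Config = Fin n → ℕ

  -- firing v: v loses deg v chips, each neighbour gains one chip
  -- (only applied when c v ≥ deg v, so truncated subtraction is exact)
  fire : Config → Fin n → Config
  fire c v w = if ⌊ w ≟ v ⌋ then c w ∸ deg v else c w + b2n (adj v w)

  add : Config → Fin n → Config
  add c v w = if ⌊ w ≟ v ⌋ then suc (c w) else c w

  run : Config → (ℕ → Fin n) → ℕ → Config
  run c s zero = c
  run c s (suc k) = fire (run c s k) (s k)

  Volatile : Config → Set
  Volatile c = Σ (ℕ → Fin n) λ s → ∀ k → deg (s k) ≤ run c s k (s k)

  data Reach : Config → Config → Set where
    done : ∀ {c} → Reach c c
    step : ∀ {c d} v → deg v ≤ c v → Reach (fire c v) d → Reach c d

  Stable : Config → Set
  Stable d = ∀ v → d v < deg v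

  data Player : Set where
    Max Min : Player

  other : Player → Player
  other Max = Min
  other Min = Max

  Opt : Player → (Fin n → ℕ) → ℕ → Set
  Opt Max f k = (∀ v → f v ≤ k) × ∃ λ v → f v ≡ k
  Opt Min f k = (∀ v → k ≤ f v) × ∃ λ v → f v ≡ k

  mutual
    -- Val p c k : from the (stable) position c with player p to move,
    -- under optimal play exactly k further chips are placed.
    data Val : Player → Config → ℕ → Set where
      move : ∀ {p c k} (f : Fin n → ℕ) →
             (∀ v → After (other p) (add c v) (f v)) →
             Opt p f k → Val p c (suc k)

    -- After p c m : c is the configuration just after a chip was placed
    -- (before firing), p moves next; m further chips will be placed.
    data After : Player → Config → ℕ → Set where
      ends : ∀ {p c} → Volatile c → After p c 0
      cont : ∀ {p c m} → ¬ Volatile c → (d : Config) → Reach c d → Stable d →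
             Val p d m → After p c m

  empty : Config
  empty _ = 0

  IsTopplingNumber : ℕ → Set
  IsTopplingNumber t = Val Max empty t

-- Firing is invisible on Kₙ once chips are read modulo n: the chips placed so far make n tokens
-- walk around a cycle with n edges, and the game is over exactly when the edge r steps before
-- the origin has been crossed at least r times, for every r (Over).
--
-- Min always crosses an edge of maximal deficit D.  If q edges fall short of the maximal deficit,
-- then chips + n D ≤ n(n-1)/2 + q(q+1)/2 because deficits of neighbouring edges differ by at most one
-- in one direction, while lowering D costs at most 2(n-q) moves; the resulting recursion ends
-- below 0.637152 n².
--
-- Max drives the surplus v of some edge up, because n(n-1)/2 + v(v+1)/2 chips are needed once it is v.
-- The next unit of surplus can be won either on the same edge or on its neighbour, and it is cheap
-- unless the deficit still available to Min is large; the resulting recursion keeps the deficit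
-- positive until v = 0.43909 n.
--
-- Both recursions are compared with explicit step functions in units of n / 10¹², which are
-- checked by computation.
module Submission where

open import Defs
open import Data.Nat
open import Data.Nat.Properties
open import Data.Nat.DivMod
open import Data.Nat.Divisibility using (divides-refl)
open import Data.Nat.Tactic.RingSolver using (solve-∀)
import Data.Nat.ListAction as List
open import Data.Bool using (Bool; true; false; not; T; if_then_else_; _∧_; _∨_)
open import Data.Bool.Properties using (T-∧; T-∨)
open import Data.Empty using (⊥-elim)
open import Data.Fin using (Fin; zero; suc)
import Data.Fin as Fin
import Data.Fin.Properties as Fin
open import Data.List using (tabulate)
open import Data.List.Properties using (map-tabulate)
open import Data.Product using (Σ; ∃; _×_; _,_; proj₁; proj₂)
open import Data.Sum using (_⊎_; inj₁; inj₂)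
open import Function using (_∘_; id; flip)
open import Function.Bundles using (Equivalence)
open import Relation.Nullary using (¬_; Dec; yes; no)
open import Relation.Nullary.Decidable using (⌊_⌋)
open import Relation.Binary.PropositionalEquality

-- After k firings the counter of edge r reads `N c (r + k)` less k, and some vertex can fire
-- exactly when the counter of edge 1 is positive; so firing never stops iff `r ≤ N c r` for every
-- r. Over one period the counters add up to the number of chips, hence the length of the game is
-- n(n-1)/2 plus the surplus wasted above r, and the players fight over this waste. Both bounds have
-- leading term (n² + x²)/2, where x is the surplus that Max has secured, or the last value of q in
-- Min's recursion.
--
-- In units of n, Min's recursion tends to q dq = (2q - 1) dD. Bringing D from 1 to 0 takes 2q - 1
-- from 1 to the root t ≈ 0.0475 of -ln t = 3 + t, and (1 + q²)/2 is then just below 0.637152. For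
-- Max, (1 + 0.43909²)/2 is just above 0.5964.
--
-- Max's difficulty is that his own chips also eat the deficit he lives on, so each unit of surplus
-- is charged for Min's replies and for those chips of Max that are themselves useful to Min.
--
-- Neither recursion is solved. Writing n = U a + b with a at least 6U² + 6, one extra unit a²
-- absorbs every term of order n, which leaves integer inequalities in which n does not occur.

-- Finite sums over initial segments of ℕ and over `Fin n`.

sumTo : ℕ → (ℕ → ℕ) → ℕ
sumTo zero    f = 0
sumTo (suc m) f = f 0 + sumTo m (f ∘ suc)

sumTo-cong : ∀ m {f g} → (∀ i → i < m → f i ≡ g i) → sumTo m f ≡ sumTo m g
sumTo-cong zero    h = refl
sumTo-cong (suc m) h = cong₂ _+_ (h 0 z<s) (sumTo-cong m λ i i<m → h (suc i) (s<s i<m))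

sumTo-mono : ∀ m {f g} → (∀ i → i < m → f i ≤ g i) → sumTo m f ≤ sumTo m g
sumTo-mono zero    h = z≤n
sumTo-mono (suc m) h = +-mono-≤ (h 0 z<s) (sumTo-mono m λ i i<m → h (suc i) (s<s i<m))

sumTo-+ : ∀ m f g → sumTo m (λ i → f i + g i) ≡ sumTo m f + sumTo m g
sumTo-+ zero    f g = refl
sumTo-+ (suc m) f g = trans (cong (f 0 + g 0 +_) (sumTo-+ m (f ∘ suc) (g ∘ suc)))
  (interchange (f 0) (g 0) (sumTo m (f ∘ suc)) (sumTo m (g ∘ suc)))
  where
  interchange : ∀ a b c d → a + b + (c + d) ≡ a + c + (b + d)
  interchange = solve-∀

sumTo-const : ∀ m c → sumTo m (λ _ → c) ≡ m * c
sumTo-const zero    c = refl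
sumTo-const (suc m) c = cong (c +_) (sumTo-const m c)

sumTo-snoc : ∀ m f → sumTo (suc m) f ≡ sumTo m f + f m
sumTo-snoc zero    f = +-comm (f 0) 0
sumTo-snoc (suc m) f = trans (cong (f 0 +_) (sumTo-snoc m (f ∘ suc)))
  (sym (+-assoc (f 0) (sumTo m (f ∘ suc)) (f (suc m))))

sumTo-append : ∀ m k f → sumTo (m + k) f ≡ sumTo m f + sumTo k (λ i → f (m + i))
sumTo-append zero    k f = refl
sumTo-append (suc m) k f = trans (cong (f 0 +_) (sumTo-append m k (f ∘ suc)))
  (sym (+-assoc (f 0) (sumTo m (f ∘ suc)) (sumTo k (λ i → f (suc m + i)))))

sumTo-update : ∀ m i {f g} → i < m → g i ≡ suc (f i) →
               (∀ j → j < m → j ≢ i → g j ≡ f j) → sumTo m g ≡ suc (sumTo m f)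
sumTo-update (suc m) zero    {f} {g} _ e h =
  cong₂ _+_ e (sumTo-cong m λ j j<m → h (suc j) (s<s j<m) λ ())
sumTo-update (suc m) (suc i) {f} {g} (s<s i<m) e h = trans
  (cong₂ _+_ (h 0 z<s λ ())
    (sumTo-update m i i<m e λ j j<m j≢i → h (suc j) (s<s j<m) (j≢i ∘ suc-injective)))
  (+-suc (f 0) _)

-- Moving the window by one replaces `f b` by the equal value `f (b + m)`.
sumTo-rotate : ∀ m b f → (∀ r → f (r + m) ≡ f r) → sumTo m (λ i → f (b + i)) ≡ sumTo m f
sumTo-rotate m zero    f per = refl
sumTo-rotate m (suc b) f per = trans
  (+-cancelˡ-≡ (f b) _ _ (trans (cong (λ x → f x + sumTo m (λ i → f (suc b + i))) (sym (+-identityʳ b)))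
    (trans (cong (f (b + 0) +_) (sumTo-cong m λ i _ → cong f (sym (+-suc b i))))
    (trans (sumTo-snoc m (λ i → f (b + i)))
    (trans (cong (sumTo m (λ i → f (b + i)) +_) (per b)) (+-comm _ (f b)))))))
  (sumTo-rotate m b f per)

2*sumTo-id : ∀ m → 2 * sumTo m id + m ≡ m * m
2*sumTo-id zero    = refl
2*sumTo-id (suc m) = trans (cong (λ x → 2 * x + suc m) (sumTo-snoc m id))
  (trans (regroup (sumTo m id) m) (trans (cong (_+ (m + suc m)) (2*sumTo-id m)) (square m)))
  where
  regroup : ∀ s m → 2 * (s + m) + suc m ≡ 2 * s + m + (m + suc m)
  regroup = solve-∀
  square : ∀ m → m * m + (m + suc m) ≡ suc m * suc m
  square = solve-∀

∑ : ∀ {n} → (Fin n → ℕ) → ℕ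
∑ f = List.sum (tabulate f)

∑-cong : ∀ {n} {f g : Fin n → ℕ} → (∀ i → f i ≡ g i) → ∑ f ≡ ∑ g
∑-cong {zero}  h = refl
∑-cong {suc n} h = cong₂ _+_ (h zero) (∑-cong (h ∘ suc))

∑-mono : ∀ {n} {f g : Fin n → ℕ} → (∀ i → f i ≤ g i) → ∑ f ≤ ∑ g
∑-mono {zero}  h = z≤n
∑-mono {suc n} h = +-mono-≤ (h zero) (∑-mono (h ∘ suc))

∑-suc : ∀ {n} (f : Fin n → ℕ) → ∑ (suc ∘ f) ≡ n + ∑ f
∑-suc {zero}  f = refl
∑-suc {suc n} f = cong suc (trans (cong (f zero +_) (∑-suc (f ∘ suc)))
  (trans (sym (+-assoc (f zero) n _)) (trans (cong (_+ ∑ (f ∘ suc)) (+-comm (f zero) n)) (+-assoc n (f zero) _))))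

∑-0 : ∀ n → ∑ {n} (λ _ → 0) ≡ 0
∑-0 zero    = refl
∑-0 (suc n) = ∑-0 n

≤∑ : ∀ {n} (f : Fin n → ℕ) i → f i ≤ ∑ f
≤∑ f zero    = m≤m+n _ _
≤∑ f (suc i) = ≤-trans (≤∑ (f ∘ suc) i) (m≤n+m _ _)

∑-update : ∀ {n} {f g : Fin n → ℕ} v → g v ≡ suc (f v) → (∀ w → w ≢ v → g w ≡ f w) → ∑ g ≡ suc (∑ f)
∑-update zero    e h = cong₂ _+_ e (∑-cong λ w → h (suc w) λ ())
∑-update {f = f} (suc v) e h = trans
  (cong₂ _+_ (h zero λ ()) (∑-update v e λ w w≢v → h (suc w) (w≢v ∘ Fin.suc-injective)))
  (+-suc (f zero) _)

∑-<⇒∃ : ∀ {n} (f g : Fin n → ℕ) → ∑ f < ∑ g → ∃ λ v → f v < g v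
∑-<⇒∃ {suc n} f g lt with f zero <? g zero
... | yes p = zero , p
... | no ¬p with ∑-<⇒∃ (f ∘ suc) (g ∘ suc)
                  (+-cancelˡ-< (f zero) _ _ (<-≤-trans lt (+-monoˡ-≤ _ (≮⇒≥ ¬p))))
...   | v , q = suc v , q

-- Division: how a quotient reacts to one more unit.

private
  quotient : ∀ x q m d .{{_ : NonZero d}} → x ≡ m + q * d → m < d → x / d ≡ q
  quotient x q m d e m<d = trans (cong (_/ d) e)
    (trans (+-distrib-/-∣ʳ m (divides-refl q)) (cong₂ _+_ (m<n⇒m/n≡0 m<d) (m*n/n≡m q d)))

[m+n]/n : ∀ m n .{{_ : NonZero n}} → (m + n) / n ≡ suc (m / n)
[m+n]/n m n = quotient (m + n) (suc (m / n)) (m % n) n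
  (trans (cong (_+ n) (m≡m%n+[m/n]*n m n))
    (trans (+-assoc (m % n) _ n) (cong (m % n +_) (+-comm _ n))))
  (m%n<n m n)

-- Exactly one of n consecutive integers is -1 modulo n, and only there does adding one carry over
-- into the quotient.
quotient-jump : ∀ n .{{_ : NonZero n}} y → ∃ λ i → i < n ×
  (suc y + i) / n ≡ suc ((y + i) / n) × (∀ j → j < n → j ≢ i → (suc y + j) / n ≡ (y + j) / n)
quotient-jump n y with y % n | y / n | m≡m%n+[m/n]*n y n | m%n<n y n
... | m | q | refl | s≤s {n = n′} m≤n′ = n′ ∸ m , s≤s (m∸n≤m n′ m) , jump , rest
  where
  above : ∀ m j k → k + suc n′ ≡ m + j → m + q * suc n′ + j ≡ k + suc q * suc n′
  above m j k e = trans (shuffle m (q * suc n′) j)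
    (trans (cong (_+ q * suc n′) (sym e)) (+-assoc k (suc n′) _))
    where
    shuffle : ∀ m x j → m + x + j ≡ m + j + x
    shuffle = solve-∀
  below : ∀ m j → m + q * suc n′ + j ≡ m + j + q * suc n′
  below m j = trans (+-assoc m _ j) (trans (cong (m +_) (+-comm (q * suc n′) j)) (sym (+-assoc m j _)))
  jump : (suc (m + q * suc n′) + (n′ ∸ m)) / suc n′ ≡ suc ((m + q * suc n′ + (n′ ∸ m)) / suc n′)
  jump = trans (quotient _ (suc q) 0 (suc n′) (above (suc m) (n′ ∸ m) 0 (cong suc (sym (m+[n∸m]≡n m≤n′)))) z<s)
    (cong suc (sym (quotient _ q n′ (suc n′)
      (trans (below m (n′ ∸ m)) (cong (_+ q * suc n′) (m+[n∸m]≡n m≤n′))) ≤-refl)))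
  rest : ∀ j → j < suc n′ → j ≢ n′ ∸ m → (suc (m + q * suc n′) + j) / suc n′ ≡ (m + q * suc n′ + j) / suc n′
  rest j j<n j≢i with suc (m + j) <? suc n′
  ... | yes lt = trans (quotient _ q (suc m + j) (suc n′) (below (suc m) j) lt)
    (sym (quotient _ q (m + j) (suc n′) (below m j) (<-trans (n<1+n _) lt)))
  ... | no ¬lt with m≤n⇒∃[o]m+o≡n (≤∧≢⇒< (s≤s⁻¹ (≮⇒≥ ¬lt)) λ n′≡m+j → j≢i (sym (trans (cong (_∸ m) n′≡m+j) (m+n∸m≡n m j))))
  ...   | k , e = trans
    (quotient _ (suc q) (suc k) (suc n′) (above (suc m) j (suc k) (cong suc (trans (+-comm k (suc n′)) e))) (small (suc m) (suc k) (s≤s m≤n′) (cong suc (trans (+-comm k (suc n′)) e))))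
    (sym (quotient _ (suc q) k (suc n′) (above m j k (trans (+-comm k (suc n′)) e)) (small m k (m≤n⇒m≤1+n m≤n′) (trans (+-comm k (suc n′)) e))))
    where
    small : ∀ m k → m ≤ suc n′ → k + suc n′ ≡ m + j → k < suc n′
    small m k m≤ e = +-cancelʳ-< (suc n′) k (suc n′) (subst (_< suc n′ + suc n′) (sym e) (+-mono-≤-< m≤ j<n))

⌊≟⌋-refl : ∀ {n} (v : Fin n) → ⌊ v Fin.≟ v ⌋ ≡ true
⌊≟⌋-refl v with v Fin.≟ v
... | yes _   = refl
... | no v≢v = ⊥-elim (v≢v refl)

⌊≟⌋-≢ : ∀ {n} {v w : Fin n} → v ≢ w → ⌊ v Fin.≟ w ⌋ ≡ false
⌊≟⌋-≢ {v = v} {w} v≢w with v Fin.≟ w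
... | yes v≡w = ⊥-elim (v≢w v≡w)
... | no _    = refl

-- The order is a parameter so that the best moves of both players come from one search.
module Extremum {A : Set} (_≼_ : A → A → Set) (total : ∀ x y → x ≼ y ⊎ y ≼ x)
                (trans≼ : ∀ {x y z} → x ≼ y → y ≼ z → x ≼ z) where

  extremum : ∀ {n} (f : Fin (suc n) → A) → ∃ λ v → ∀ w → f w ≼ f v
  extremum {zero} f = zero , λ { zero → refl≼ }
    where
    refl≼ : ∀ {x} → x ≼ x
    refl≼ {x} with total x x
    ... | inj₁ h = h
    ... | inj₂ h = h
  extremum {suc n} f with extremum (f ∘ suc)
  ... | v , max with total (f zero) (f (suc v))
  ...   | inj₁ h = suc v , λ { zero → h ; (suc w) → max w }
  ...   | inj₂ h with total (f zero) (f zero)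
  ...     | inj₁ r = zero , λ { zero → r ; (suc w) → trans≼ (max w) h }
  ...     | inj₂ r = zero , λ { zero → r ; (suc w) → trans≼ (max w) h }

-- The cycle picture of firing on the complete graph, and the transfer of strategies to it.

module Complete (p : ℕ) where

  n : ℕ
  n = suc p

  open Toppling (K n) public

  deg≡p : ∀ v → deg v ≡ p
  deg≡p v = trans (cong List.sum (map-tabulate id (λ w → b2n (not ⌊ v Fin.≟ w ⌋))))
    (suc-injective (trans (sym (∑-update v (cong (λ b → suc (b2n (not b))) (sym (⌊≟⌋-refl v)))
        λ w w≢v → cong (b2n ∘ not) (sym (⌊≟⌋-≢ (w≢v ∘ sym)))))
      (ones n)))
    where
    ones : ∀ k → ∑ {k} (λ _ → 1) ≡ k
    ones zero    = refl
    ones (suc k) = cong suc (ones k)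

  -- On K n a configuration is, up to firing, n tokens on a cycle of length n: firing only
  -- rotates the cycle.  N c r counts the passages of the r-th edge before the origin.
  N : Config → ℕ → ℕ
  N c r = ∑ λ w → (c w + r) / n

  Over : Config → Set
  Over c = ∀ r → r ≤ N c r

  -- By Hermite's identity this is the number of chips; `S-empty` and `S-add` recover it for
  -- configurations built chip by chip.
  S : Config → ℕ
  S c = sumTo n (N c)

  N-mono : ∀ c r → N c r ≤ N c (suc r)
  N-mono c r = ∑-mono λ w → /-monoˡ-≤ n (+-monoʳ-≤ (c w) (n≤1+n r))

  N-period : ∀ c r → N c (r + n) ≡ N c r + n
  N-period c r = trans (∑-cong λ w → trans (cong (_/ n) (sym (+-assoc (c w) r n))) ([m+n]/n (c w + r) n))
    (trans (∑-suc (λ w → (c w + r) / n)) (+-comm n (N c r)))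

  add-at : ∀ c v → add c v v ≡ suc (c v)
  add-at c v rewrite ⌊≟⌋-refl v = refl

  add-off : ∀ c v w → w ≢ v → add c v w ≡ c w
  add-off c v w w≢v rewrite ⌊≟⌋-≢ w≢v = refl

  fire-at : ∀ c v → fire c v v ≡ c v ∸ p
  fire-at c v rewrite ⌊≟⌋-refl v = cong (c v ∸_) (deg≡p v)

  fire-off : ∀ c v w → w ≢ v → fire c v w ≡ suc (c w)
  fire-off c v w w≢v rewrite ⌊≟⌋-≢ w≢v | ⌊≟⌋-≢ (w≢v ∘ sym) = +-comm (c w) 1

  N-add-jump : ∀ c v r → (suc (c v) + r) / n ≡ suc ((c v + r) / n) → N (add c v) r ≡ suc (N c r)
  N-add-jump c v r e = ∑-update v (trans (cong (λ x → (x + r) / n) (add-at c v)) e)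
    λ w w≢v → cong (λ x → (x + r) / n) (add-off c v w w≢v)

  N-add-flat : ∀ c v r → (suc (c v) + r) / n ≡ (c v + r) / n → N (add c v) r ≡ N c r
  N-add-flat c v r e = ∑-cong λ w → cases w (w Fin.≟ v)
    where
    cases : ∀ w → Dec (w ≡ v) → (add c v w + r) / n ≡ (c w + r) / n
    cases w (yes refl) = trans (cong (λ x → (x + r) / n) (add-at c v)) e
    cases w (no w≢v)   = cong (λ x → (x + r) / n) (add-off c v w w≢v)

  -- One chip takes one token over one edge. The window of n edges may start anywhere, since edges
  -- are later counted from a moving base b.
  Bump : (ℕ → ℕ) → (ℕ → ℕ) → Set
  Bump f g = ∀ b → ∃ λ i → i < n × g (b + i) ≡ suc (f (b + i)) ×
                   (∀ j → j < n → j ≢ i → g (b + j) ≡ f (b + j))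

  add-bump : ∀ c v → Bump (N c) (N (add c v))
  add-bump c v b with quotient-jump n (c v + b)
  ... | i , i<n , jump , flat = i , i<n ,
    N-add-jump c v (b + i) (subst₂ (λ x y → x / n ≡ suc (y / n)) (assoc₁ i) (assoc₀ i) jump) ,
    λ j j<n j≢i → N-add-flat c v (b + j) (subst₂ (λ x y → x / n ≡ y / n) (assoc₁ j) (assoc₀ j) (flat j j<n j≢i))
    where
    assoc₀ : ∀ i → c v + b + i ≡ c v + (b + i)
    assoc₀ = +-assoc (c v) b
    assoc₁ : ∀ i → suc (c v + b) + i ≡ suc (c v) + (b + i)
    assoc₁ i = cong suc (assoc₀ i)

  -- A counter that increases from r to r + 1 betrays a token waiting right behind edge r, and a
  -- chip on it crosses that edge. Both players aim at edges in this way.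
  token-behind : ∀ c r → N c r < N c (suc r) → ∃ λ v → N (add c v) r ≡ suc (N c r)
  token-behind c r lt with ∑-<⇒∃ (λ w → (c w + r) / n) (λ w → (c w + suc r) / n) lt
  ... | v , q = v , N-add-jump c v r (≤-antisym below (subst (λ x → suc ((c v + r) / n) ≤ x / n) (+-suc (c v) r) q))
    where
    below : (suc (c v) + r) / n ≤ suc ((c v + r) / n)
    below = ≤-trans (/-monoˡ-≤ n (subst (suc (c v + r) ≤_) (sym (+-suc (c v + r) p)) (s≤s (m≤m+n (c v + r) p))))
      (≤-reflexive ([m+n]/n (c v + r) n))

  -- Modulo n, firing adds one to every entry; the fired vertex loses n besides, which is the single
  -- passage lost.
  N-fire : ∀ c v r → deg v ≤ c v → suc (N (fire c v) r) ≡ N c (suc r)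
  N-fire c v r leg = sym (∑-update v fired λ w w≢v →
    cong (_/ n) (trans (+-suc (c w) r) (cong (_+ r) (sym (fire-off c v w w≢v)))))
    where
    open ≡-Reasoning
    shift : ∀ x r p → x + p + suc r ≡ x + r + suc p
    shift = solve-∀
    fired : (c v + suc r) / n ≡ suc ((fire c v v + r) / n)
    fired = begin
      (c v + suc r) / n           ≡⟨ cong (λ x → (x + suc r) / n) (m∸n+n≡m (subst (_≤ c v) (deg≡p v) leg)) ⟨
      (c v ∸ p + p + suc r) / n   ≡⟨ cong (_/ n) (shift (c v ∸ p) r p) ⟩
      (c v ∸ p + r + n) / n       ≡⟨ [m+n]/n (c v ∸ p + r) n ⟩
      suc ((c v ∸ p + r) / n)     ≡⟨ cong (λ x → suc ((x + r) / n)) (fire-at c v) ⟨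
      suc ((fire c v v + r) / n)  ∎

  S-add : ∀ c v → S (add c v) ≡ suc (S c)
  S-add c v with add-bump c v 0
  ... | i , i<n , at , off = sumTo-update n i i<n at off

  S-empty : S empty ≡ 0
  S-empty = trans (sumTo-cong n {N empty} {λ _ → 0} λ r r<n → trans (∑-cong {n} {λ _ → r / n} {λ _ → 0} λ _ → m<n⇒m/n≡0 r<n) (∑-0 n))
    (trans (sumTo-const n 0) (*-zeroʳ n))

  stable? : ∀ c → Stable c ⊎ ∃ λ v → deg v ≤ c v
  stable? c with Fin.any? (λ v → deg v ≤? c v)
  ... | yes h = inj₂ h
  ... | no ¬h = inj₁ λ v → ≰⇒> λ h → ¬h (v , h)

  N1-stable : ∀ c → Stable c → N c 1 ≡ 0
  N1-stable c st = trans (∑-cong λ w → m<n⇒m/n≡0 (subst (_< n) (+-comm 1 (c w))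
    (s<s (subst (c w <_) (deg≡p w) (st w))))) (∑-0 n)

  N1-unstable : ∀ c v → deg v ≤ c v → 1 ≤ N c 1
  N1-unstable c v leg = ≤-trans (≤-reflexive (sym (n/n≡1 n)))
    (≤-trans (/-monoˡ-≤ n (subst (n ≤_) (+-comm 1 (c v)) (s≤s (subst (_≤ c v) (deg≡p v) leg))))
      (≤∑ (λ w → (c w + 1) / n) v))

  Over-fire : ∀ c v → deg v ≤ c v → Over c → Over (fire c v)
  Over-fire c v leg over r = s≤s⁻¹ (subst (suc r ≤_) (sym (N-fire c v r leg)) (over (suc r)))

  Over-unfire : ∀ c v → deg v ≤ c v → Over (fire c v) → Over c
  Over-unfire c v leg over zero    = z≤n
  Over-unfire c v leg over (suc r) = subst (suc r ≤_) (N-fire c v r leg) (s≤s (over r))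

  Over⇒unstable : ∀ {c} → Over c → ¬ Stable c
  Over⇒unstable {c} over st = 1+n≰n (subst (1 ≤_) (N1-stable c st) (over 1))

  -- A legal firing after k firings shows that the counter of edge 1, by then `N c (suc k)` less k,
  -- is at least one.
  Volatile⇒Over : ∀ {c} → Volatile c → Over c
  Volatile⇒Over vol zero = z≤n
  Volatile⇒Over {c} (s , legal) (suc k) = subst (suc k ≤_) (shift k 1) (+-monoˡ-≤ k (N1-unstable (run c s k) (s k) (legal k)))
    where
    shift : ∀ k r → N (run c s k) r + k ≡ N c (r + k)
    shift zero    r = trans (+-identityʳ _) (cong (N c) (sym (+-identityʳ r)))
    shift (suc k) r = trans (+-suc _ k) (trans (cong (_+ k) (N-fire (run c s k) (s k) r (legal k)))
      (trans (shift k (suc r)) (cong (N c) (sym (+-suc r k)))))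

  -- `Over` survives firing and excludes stability, so there is always a next vertex to fire.
  Over⇒Volatile : ∀ c → Over c → Volatile c
  Over⇒Volatile c over = (λ k → chosen (orbit k)) , λ k →
    subst (λ d → deg (chosen (orbit k)) ≤ d (chosen (orbit k))) (follows k) (legal (orbit k))
    where
    pick : (s : Σ Config Over) → ∃ λ v → deg v ≤ proj₁ s v
    pick (d , o) with stable? d
    ... | inj₁ st = ⊥-elim (Over⇒unstable {d} o st)
    ... | inj₂ h  = h
    chosen : Σ Config Over → Fin n
    chosen s = proj₁ (pick s)
    legal : ∀ s → deg (chosen s) ≤ proj₁ s (chosen s)
    legal s = proj₂ (pick s)
    orbit : ℕ → Σ Config Over
    orbit zero    = c , over
    orbit (suc k) = fire (proj₁ (orbit k)) (chosen (orbit k)) ,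
                    Over-fire (proj₁ (orbit k)) (chosen (orbit k)) (legal (orbit k)) (proj₂ (orbit k))
    follows : ∀ k → proj₁ (orbit k) ≡ run c (λ j → chosen (orbit j)) k
    follows zero    = refl
    follows (suc k) = cong (λ d → fire d (chosen (orbit k))) (follows k)

  -- The witness r of `N c r < r` serves as fuel: each firing moves it down by one, and it cannot
  -- reach zero.
  stabilise : ∀ r c → N c r < r → ∃ λ d → Reach c d × Stable d
  stabilise (suc r) c lt with stable? c
  ... | inj₁ st = c , done , st
  ... | inj₂ (v , leg) with stabilise r (fire c v) (s<s⁻¹ (subst (_< suc r) (sym (N-fire c v r leg)) lt))
  ...   | d , reach , st = d , step v leg reach , st

  least? : ∀ m (f : ℕ → ℕ) → (∃ λ r → r < m × f r < r) ⊎ (∀ r → r < m → r ≤ f r)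
  least? zero    f = inj₂ λ _ ()
  least? (suc m) f with least? m f | f m <? m
  ... | inj₁ (r , r<m , lt) | _     = inj₁ (r , m<n⇒m<1+n r<m , lt)
  ... | inj₂ _              | yes h = inj₁ (m , ≤-refl , h)
  ... | inj₂ all            | no ¬h = inj₂ λ r r<1+m → cases r (m≤n⇒m<n∨m≡n (s≤s⁻¹ r<1+m))
    where
    cases : ∀ r → r < m ⊎ r ≡ m → r ≤ f r
    cases r (inj₁ r<m)  = all r r<m
    cases r (inj₂ refl) = ≮⇒≥ ¬h

  periodic-≤ : ∀ c D → (∀ r → r < n → r ≤ N c r + D) → ∀ r → r ≤ N c r + D
  periodic-≤ c D h r = subst (λ x → x ≤ N c x + D) (sym (m≡m%n+[m/n]*n r n)) (lift (r / n) (r % n) (m%n<n r n))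
    where
    lift : ∀ q x → x < n → x + q * n ≤ N c (x + q * n) + D
    lift zero    x x<n = subst (λ y → y ≤ N c y + D) (sym (+-identityʳ x)) (h x x<n)
    lift (suc q) x x<n = subst (λ y → y ≤ N c y + D) (reassoc x n (q * n))
      (subst (x + q * n + n ≤_) (trans (swap (N c (x + q * n)) n D) (cong (_+ D) (sym (N-period c (x + q * n)))))
        (+-monoˡ-≤ n (lift q x x<n)))
      where
      reassoc : ∀ x n y → x + y + n ≡ x + (n + y)
      reassoc = solve-∀
      swap : ∀ a b c → a + c + b ≡ a + b + c
      swap = solve-∀

  over? : ∀ c → (∃ λ r → r < n × N c r < r) ⊎ Over c
  over? c with least? n (N c)
  ... | inj₁ h = inj₁ h
  ... | inj₂ h = inj₂ λ r → subst (r ≤_) (+-identityʳ _)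
    (periodic-≤ c 0 (λ r r<n → subst (r ≤_) (sym (+-identityʳ _)) (h r r<n)) r)

  N-cong : ∀ {c d} → c ≗ d → ∀ r → N c r ≡ N d r
  N-cong e r = ∑-cong λ w → cong (λ x → (x + r) / n) (e w)

  fire-cong : ∀ {c d} v → c ≗ d → fire c v ≗ fire d v
  fire-cong v e w with ⌊ w Fin.≟ v ⌋
  ... | true  = cong (_∸ deg v) (e w)
  ... | false = cong (_+ b2n (not ⌊ v Fin.≟ w ⌋)) (e w)

  add-cong : ∀ {c d} v → c ≗ d → add c v ≗ add d v
  add-cong v e w with ⌊ w Fin.≟ v ⌋
  ... | true  = cong suc (e w)
  ... | false = e w

  c≤add : ∀ c v w → c w ≤ add c v w
  c≤add c v w with ⌊ w Fin.≟ v ⌋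
  ... | true  = n≤1+n _
  ... | false = ≤-refl

  add-fire : ∀ c v w → deg w ≤ c w → add (fire c w) v ≗ fire (add c v) w
  add-fire c v w leg u with u Fin.≟ v | u Fin.≟ w
  ... | yes refl | yes refl = sym (+-∸-assoc 1 leg)
  ... | yes _    | no _     = refl
  ... | no _     | yes _    = refl
  ... | no _     | no _     = refl

  -- `Reach` up to pointwise equality: adding a chip and firing commute only pointwise, and
  -- configurations are functions.
  infix 4 _⇝_
  data _⇝_ : Config → Config → Set where
    same : ∀ {c d} → c ≗ d → c ⇝ d
    step : ∀ {c d} v → deg v ≤ c v → fire c v ⇝ d → c ⇝ d

  ⇝-resp : ∀ {c c′ d} → c ≗ c′ → c ⇝ d → c′ ⇝ d
  ⇝-resp e (same h)       = same λ w → trans (sym (e w)) (h w)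
  ⇝-resp e (step v leg r) = step v (subst (deg v ≤_) (e v) leg) (⇝-resp (fire-cong v e) r)

  -- An extra chip never disables a firing, so a firing sequence can be postponed past it.
  ⇝-add : ∀ {c d} v → c ⇝ d → add c v ⇝ add d v
  ⇝-add v (same h)           = same (add-cong v h)
  ⇝-add {c} v (step w leg r) = step w (≤-trans leg (c≤add c v w)) (⇝-resp (add-fire c v w leg) (⇝-add v r))

  ⇝-Reach : ∀ {c d e} → c ⇝ d → Reach d e → c ⇝ e
  ⇝-Reach (step v leg r) s           = step v leg (⇝-Reach r s)
  ⇝-Reach (same h) done              = same h
  ⇝-Reach (same h) (step v leg s)    =
    step v (subst (deg v ≤_) (sym (h v)) leg) (⇝-Reach (same (fire-cong v h)) s)

  Over-⇝ : ∀ {c d} → c ⇝ d → Over c → Over d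
  Over-⇝ (same h) over           r = subst (r ≤_) (N-cong h r) (over r)
  Over-⇝ {c} (step v leg s) over r = Over-⇝ s (Over-fire c v leg over) r

  Over-⇜ : ∀ {c d} → c ⇝ d → Over d → Over c
  Over-⇜ (same h) over       r = subst (r ≤_) (sym (N-cong h r)) (over r)
  Over-⇜ {c} (step v leg s) over = Over-unfire c v leg (Over-⇜ s over)

  -- A play is followed by the configuration c̃ of all chips placed so far, never fired.
  module MinStrategy (Θ : ℕ) (PMax PMin : Config → Set)
    (max-moves : ∀ c → PMax c → ∀ v → S (add c v) ≤ Θ × (Over (add c v) ⊎ PMin (add c v)))
    (min-moves : ∀ c → PMin c → ∃ λ v → S (add c v) ≤ Θ × (Over (add c v) ⊎ PMax (add c v))) where

    P : Player → Config → Set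
    P Max = PMax
    P Min = PMin

    mutual
      value≤ : ∀ {q c c̃ k} → c̃ ⇝ c → P q c̃ → Val q c k → k + S c̃ ≤ Θ
      value≤ {Max} {c} {c̃} c̃⇝c st (move f after (_ , v , refl)) with max-moves c̃ st v
      ... | bound , next = subst (_≤ Θ) (trans (cong (f v +_) (S-add c̃ v)) (+-suc (f v) (S c̃)))
        (after≤ (⇝-add v c̃⇝c) bound next (after v))
      value≤ {Min} {c} {c̃} c̃⇝c st (move {k = k} f after (least , _)) with min-moves c̃ st
      ... | v , bound , next = ≤-trans (s≤s (+-monoˡ-≤ (S c̃) (least v)))
        (subst (_≤ Θ) (trans (cong (f v +_) (S-add c̃ v)) (+-suc (f v) (S c̃)))
          (after≤ (⇝-add v c̃⇝c) bound next (after v)))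

      after≤ : ∀ {q c c̃ k} → c̃ ⇝ c → S c̃ ≤ Θ → Over c̃ ⊎ P q c̃ → After q c k → k + S c̃ ≤ Θ
      after≤ c̃⇝c bound _           (ends _)                = bound
      after≤ c̃⇝c bound (inj₁ over) (cont _ _ reach st _)   =
        ⊥-elim (Over⇒unstable (Over-⇝ (⇝-Reach c̃⇝c reach) over) st)
      after≤ c̃⇝c bound (inj₂ next) (cont _ _ reach _ val)  = value≤ (⇝-Reach c̃⇝c reach) next val

  -- In contrast to Min's side no bound is kept during play: it suffices that an invariant position
  -- which is over already holds Θ chips.
  module MaxStrategy (Θ : ℕ) (QMax QMin : Config → Set)
    (max-moves : ∀ c → QMax c → ∃ λ v → QMin (add c v))
    (min-moves : ∀ c → QMin c → ∀ v → QMax (add c v))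
    (max-over : ∀ c → QMax c → Over c → Θ ≤ S c)
    (min-over : ∀ c → QMin c → Over c → Θ ≤ S c) where

    Q : Player → Config → Set
    Q Max = QMax
    Q Min = QMin

    over-late : ∀ q c → Q q c → Over c → Θ ≤ S c
    over-late Max = max-over
    over-late Min = min-over

    mutual
      ≤value : ∀ {q c c̃ k} → c̃ ⇝ c → Q q c̃ → Val q c k → Θ ≤ k + S c̃
      ≤value {Max} {c} {c̃} c̃⇝c st (move f after (greatest , _)) with max-moves c̃ st
      ... | v , next = ≤-trans (subst (Θ ≤_) (trans (cong (f v +_) (S-add c̃ v)) (+-suc (f v) (S c̃)))
          (≤after (⇝-add v c̃⇝c) next (after v)))
        (s≤s (+-monoˡ-≤ (S c̃) (greatest v)))
      ≤value {Min} {c} {c̃} c̃⇝c st (move f after (_ , v , refl)) =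
        subst (Θ ≤_) (trans (cong (f v +_) (S-add c̃ v)) (+-suc (f v) (S c̃)))
          (≤after (⇝-add v c̃⇝c) (min-moves c̃ st v) (after v))

      ≤after : ∀ {q c c̃ k} → c̃ ⇝ c → Q q c̃ → After q c k → Θ ≤ k + S c̃
      ≤after {q} c̃⇝c st (ends vol)             = over-late q _ st (Over-⇜ c̃⇝c (Volatile⇒Over vol))
      ≤after     c̃⇝c st (cont _ _ reach _ val) = ≤value (⇝-Reach c̃⇝c reach) st val

  -- If r < n is a witness against `Over`, every counter in the window is at most `N c (r + n)`,
  -- which is `N c r + n` and less than 2n.
  S-bound : ∀ c r → r < n → N c r < r → S c < n * (n + n)
  S-bound c r r<n lt = <-≤-trans (s≤s (sumTo-mono n below)) (≤-trans (≤-reflexive (cong suc (sumTo-const n (p + n))))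
    (subst (_≤ n * (n + n)) (+-comm (n * (p + n)) 1) (subst (n * (p + n) + 1 ≤_) (sym (*-suc′ n (p + n))) (+-monoʳ-≤ (n * (p + n)) z<s))))
    where
    *-suc′ : ∀ a b → a * suc b ≡ a * b + a
    *-suc′ = solve-∀
    mono : ∀ k r → N c r ≤ N c (k + r)
    mono zero    r = ≤-refl
    mono (suc k) r = ≤-trans (mono k r) (N-mono c (k + r))
    below : ∀ i → i < n → N c i ≤ p + n
    below i i<n = ≤-trans (mono (r + n ∸ i) i) (subst (_≤ p + n) (sym (trans (cong (N c) (m∸n+n≡m (≤-trans (<⇒≤ i<n) (m≤n+m n r)))) (N-period c r)))
      (+-monoˡ-≤ n (s≤s⁻¹ (<-trans lt r<n))))

  -- Backward induction on the chips still possible: by `S-bound` a position with n(n + n) chips is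
  -- over.
  value-exists : ∀ fuel q c c̃ → c̃ ⇝ c → Stable c → n * (n + n) ≤ S c̃ + fuel → ∃ λ k → Val q c k
  value-exists fuel q c c̃ c̃⇝c st big with over? c̃
  ... | inj₂ over = ⊥-elim (Over⇒unstable (Over-⇝ c̃⇝c over) st)
  value-exists zero q c c̃ c̃⇝c st big | inj₁ (r , r<n , lt) =
    ⊥-elim (<-irrefl refl (≤-<-trans (subst (n * (n + n) ≤_) (+-identityʳ _) big) (S-bound c̃ r r<n lt)))
  value-exists (suc fuel) q c c̃ c̃⇝c st big | inj₁ _ = suc (proj₁ (opt q)) , move value after (proj₂ (opt q))
    where
    outcome : ∀ v → ∃ λ k → After (other q) (add c v) k
    outcome v with over? (add c v)
    ... | inj₂ over = 0 , ends (Over⇒Volatile _ over)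
    ... | inj₁ (r , _ , lt) with stabilise r (add c v) lt
    ...   | d , reach , std with value-exists fuel (other q) d (add c̃ v) (⇝-Reach (⇝-add v c̃⇝c) reach) std
              (subst (n * (n + n) ≤_) (trans (+-suc (S c̃) fuel) (cong (_+ fuel) (sym (S-add c̃ v)))) big)
    ...     | k , val = k , cont (λ vol → <⇒≱ lt (Volatile⇒Over vol r)) d reach std val
    value : Fin n → ℕ
    value v = proj₁ (outcome v)
    after : ∀ v → After (other q) (add c v) (value v)
    after v = proj₂ (outcome v)
    opt : ∀ q → ∃ λ k → Opt q value k
    opt Max with Extremum.extremum _≤_ ≤-total ≤-trans value
    ... | v , greatest = value v , greatest , v , refl
    opt Min with Extremum.extremum _≥_ (flip ≤-total) (flip ≤-trans) value
    ... | v , least = value v , least , v , refl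

-- Upper bound: Min lowers the maximal deficit.

sgn : ℕ → ℕ
sgn zero    = 0
sgn (suc _) = 1

sgn-mono : ∀ {x y} → x ≤ y → sgn x ≤ sgn y
sgn-mono z≤n     = z≤n
sgn-mono (s≤s _) = ≤-refl

sgn≤1 : ∀ x → sgn x ≤ 1
sgn≤1 zero    = z≤n
sgn≤1 (suc _) = ≤-refl

sumTo-strict : ∀ m i {f g} → i < m → f i < g i → (∀ j → j < m → f j ≤ g j) → sumTo m f < sumTo m g
sumTo-strict (suc m) zero    _         lt h = +-mono-<-≤ lt (sumTo-mono m λ j j<m → h (suc j) (s<s j<m))
sumTo-strict (suc m) (suc i) (s<s i<m) lt h =
  +-mono-≤-< (h 0 z<s) (sumTo-strict m i i<m lt λ j j<m → h (suc j) (s<s j<m))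

zero? : ∀ m (f : ℕ → ℕ) → (∃ λ r → r < m × f r ≡ 0) ⊎ (∀ r → r < m → 1 ≤ f r)
zero? zero    f = inj₂ λ _ ()
zero? (suc m) f with f 0 in e
... | zero  = inj₁ (0 , z<s , e)
... | suc _ with zero? m (f ∘ suc)
...   | inj₁ (r , r<m , z) = inj₁ (suc r , s<s r<m , z)
...   | inj₂ pos           = inj₂ λ { zero _ → subst (1 ≤_) (sym e) z<s ; (suc r) (s<s r<m) → pos r r<m }

-- Walking down to a zero by steps of at most one, the k-th nonzero value is at most k.
staircase : ∀ m (g : ℕ → ℕ) → (∀ i → g i ≤ suc (g (suc i))) → g m ≡ 0 →
            let q = sumTo m (sgn ∘ g) in g 0 ≤ q × 2 * sumTo m g ≤ q * q + q
staircase zero    g slow end = ≤-reflexive end , z≤n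
staircase (suc m) g slow end with staircase m (g ∘ suc) (slow ∘ suc) end | g 0 | slow 0
... | _ , area      | zero  | _  = z≤n , area
... | height , area | suc x | le = s≤s (≤-trans (s≤s⁻¹ le) height) , (begin
  2 * (suc x + Σg)           ≡⟨ *-distribˡ-+ 2 (suc x) Σg ⟩
  2 * suc x + 2 * Σg         ≤⟨ +-mono-≤ (*-monoʳ-≤ 2 (s≤s (≤-trans (s≤s⁻¹ le) height))) area ⟩
  2 * suc q + (q * q + q)    ≡⟨ square q ⟩
  suc q * suc q + suc q      ∎)
  where
  open ≤-Reasoning
  Σg q : ℕ
  Σg = sumTo m (g ∘ suc)
  q  = sumTo m (sgn ∘ g ∘ suc)
  square : ∀ q → 2 * suc q + (q * q + q) ≡ suc q * suc q + suc q
  square = solve-∀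

module Upper (p : ℕ) where
  open Complete p

  -- M bounds twice (chips placed + n × D) when the deficit r - N r has come down to D everywhere.
  data Descent (Θ : ℕ) : ℕ → ℕ → Set where
    end  : ∀ {M} → M + 4 ≤ 2 * Θ → Descent Θ 0 M
    step : ∀ {D M} Q M′ → 3 ≤ Q → Q ≤ n → M + 2 * n + 4 ≤ M′ + 4 * Q →
           n * n + Q * Q + n + 4 ≤ M′ + 3 * Q → Descent Θ D M′ → Descent Θ (suc D) M

  -- As `Q ≤ n`, a step of D lowers M by less than 2n.
  Descent-bound : ∀ {Θ D M} → Descent Θ D M → M + 4 ≤ 2 * Θ + 2 * (n * D)
  Descent-bound {Θ} (end h) = ≤-trans h (m≤m+n _ _)
  Descent-bound {Θ} {suc D} {M} (step Q M′ _ Q≤n drop _ d) = +-cancelʳ-≤ (2 * n + 4) _ _ (begin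
    M + 4 + (2 * n + 4)                  ≡⟨ e₁ M n ⟩
    M + 2 * n + 4 + 4                    ≤⟨ +-monoˡ-≤ 4 drop ⟩
    M′ + 4 * Q + 4                       ≡⟨ e₂ M′ Q ⟩
    M′ + 4 + 4 * Q                       ≤⟨ +-mono-≤ (Descent-bound d) (*-monoʳ-≤ 4 Q≤n) ⟩
    2 * Θ + 2 * (n * D) + 4 * n          ≤⟨ m≤m+n _ 4 ⟩
    2 * Θ + 2 * (n * D) + 4 * n + 4      ≡⟨ e₃ Θ n D ⟩
    2 * Θ + 2 * (n * suc D) + (2 * n + 4) ∎)
    where
    open ≤-Reasoning
    e₁ : ∀ M n → M + 4 + (2 * n + 4) ≡ M + 2 * n + 4 + 4
    e₁ = solve-∀
    e₂ : ∀ M Q → M + 4 * Q + 4 ≡ M + 4 + 4 * Q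
    e₂ = solve-∀
    e₃ : ∀ Θ n D → 2 * Θ + 2 * (n * D) + 4 * n + 4 ≡ 2 * Θ + 2 * (n * suc D) + (2 * n + 4)
    e₃ = solve-∀

  Need : ℕ → Config → Set
  Need D c = ∀ r → r ≤ N c r + D

  -- How far edge r falls short of the deficit D; the subtraction is exact under `Need D c`. Zero
  -- excess means that the edge has the full deficit D.
  excess : ℕ → Config → ℕ → ℕ
  excess D c r = N c r + D ∸ r

  q : ℕ → Config → ℕ
  q D c = sumTo n (sgn ∘ excess D c)

  q≤n : ∀ D c → q D c ≤ n
  q≤n D c = ≤-trans (sumTo-mono n λ r _ → sgn≤1 (excess D c r))
    (≤-reflexive (trans (sumTo-const n 1) (*-identityʳ n)))

  N≤N-add : ∀ c v r → N c r ≤ N (add c v) r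
  N≤N-add c v r = ∑-mono λ w → /-monoˡ-≤ n (+-monoˡ-≤ r (c≤add c v w))

  Need-add : ∀ {D} c v → Need D c → Need D (add c v)
  Need-add {D} c v need r = ≤-trans (need r) (+-monoˡ-≤ D (N≤N-add c v r))

  excess-add : ∀ D c v r → excess D c r ≤ excess D (add c v) r
  excess-add D c v r = ∸-monoˡ-≤ r (+-monoˡ-≤ D (N≤N-add c v r))

  q-add : ∀ D c v → q D c ≤ q D (add c v)
  q-add D c v = sumTo-mono n λ r _ → sgn-mono (excess-add D c v r)

  isoperimetry : ∀ D c → Need D c → (∃ λ r → r < n × excess D c r ≡ 0) →
                 2 * S c + 2 * (n * D) + n ≤ q D c * q D c + q D c + n * n
  isoperimetry D c need (r₀ , _ , e₀) = begin
    2 * S c + 2 * (n * D) + n                  ≡⟨ e₁ (S c) (n * D) n ⟩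
    2 * (S c + n * D) + n                      ≡⟨ cong (λ x → 2 * x + n) (sym total) ⟩
    2 * (sumTo n f + sumTo n id) + n           ≡⟨ e₂ (sumTo n f) (sumTo n id) n ⟩
    2 * sumTo n f + (2 * sumTo n id + n)       ≡⟨ cong (2 * sumTo n f +_) (2*sumTo-id n) ⟩
    2 * sumTo n f + n * n                      ≤⟨ +-monoˡ-≤ (n * n) area ⟩
    q D c * q D c + q D c + n * n              ∎
    where
    open ≤-Reasoning
    f : ℕ → ℕ
    f = excess D c
    e₁ : ∀ S x n → 2 * S + 2 * x + n ≡ 2 * (S + x) + n
    e₁ = solve-∀
    e₂ : ∀ a b n → 2 * (a + b) + n ≡ 2 * a + (2 * b + n)
    e₂ = solve-∀
    e₃ : ∀ a n D → a + n + D ≡ n + (a + D)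
    e₃ = solve-∀
    total : sumTo n f + sumTo n id ≡ S c + n * D
    total = trans (sym (sumTo-+ n f id)) (trans (sumTo-cong n λ r _ → m∸n+n≡m (need r))
      (trans (sumTo-+ n (N c) (λ _ → D)) (cong (S c +_) (sumTo-const n D))))
    periodic : ∀ r → f (r + n) ≡ f r
    periodic r = trans (cong₂ _∸_ (trans (cong (_+ D) (N-period c r)) (e₃ (N c r) n D)) (+-comm r n))
      ([m+n]∸[m+o]≡n∸o n (N c r + D) r)
    slow : ∀ r → f r ≤ suc (f (suc r))
    slow r = +-cancelʳ-≤ r _ _ (begin
      f r + r                ≡⟨ m∸n+n≡m (need r) ⟩
      N c r + D              ≤⟨ +-monoˡ-≤ D (N-mono c r) ⟩
      N c (suc r) + D        ≡⟨ sym (m∸n+n≡m (need (suc r))) ⟩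
      f (suc r) + suc r      ≡⟨ +-suc (f (suc r)) r ⟩
      suc (f (suc r)) + r    ∎)
    -- The window starting at an edge of zero excess also ends at one, a period later, as
    -- `staircase` demands.
    rotated = staircase n (λ i → f (r₀ + i))
      (λ i → subst (λ x → f (r₀ + i) ≤ suc (f x)) (sym (+-suc r₀ i)) (slow (r₀ + i)))
      (trans (periodic r₀) e₀)
    area : 2 * sumTo n f ≤ q D c * q D c + q D c
    area = subst₂ (λ s k → 2 * s ≤ k * k + k) (sumTo-rotate n r₀ f periodic)
      (sumTo-rotate n r₀ (sgn ∘ f) (cong sgn ∘ periodic)) (proj₂ rotated)

  module Play (Θ : ℕ) where

    -- A potential: each of the n - q edges still at deficit D + 1 costs at most a round of two
    -- chips, hence 4 after doubling. `spare` is 4 with Max to move and 2 with Min to move.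
    Phase : ℕ → Config → Set
    Phase spare c = ∃ λ D → ∃ λ M → Descent Θ D M × Need (suc D) c ×
      2 * S c + 4 * n + spare + 2 * (n * D) ≤ M + 4 * q (suc D) c

    tighten : ∀ D c → (∀ r → r < n → 1 ≤ excess (suc D) c r) → Need D c
    tighten D c pos = periodic-≤ c D λ r r<n →
      s≤s⁻¹ (subst (suc r ≤_) (+-suc (N c r) D) (below r (pos r r<n)))
      where
      below : ∀ {x} r → 1 ≤ x ∸ r → suc r ≤ x
      below {x} r h = ≰⇒> λ x≤r → <⇒≱ h (≤-reflexive (m≤n⇒m∸n≡0 x≤r))

    settle : ∀ {D M} c → Descent Θ D M → Need D c → 2 * S c + 2 * (n * D) ≤ M → Over c ⊎ Phase 4 c
    settle c (end _) need _ = inj₁ λ r → subst (r ≤_) (+-identityʳ _) (need r)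
    settle {suc D} {M} c (step Q M′ 3≤Q Q≤n drop base d) need bound with zero? n (excess (suc D) c)
    -- No edge has the full deficit any more, so D drops without a phase.
    ... | inj₂ pos = settle c d (tighten D c pos) (+-cancelʳ-≤ (4 * n + 4) _ _ (begin
      2 * S c + 2 * (n * D) + (4 * n + 4)   ≡⟨ e₁ (S c) n D ⟩
      2 * S c + 2 * (n * suc D) + 2 * n + 4 ≤⟨ +-monoˡ-≤ 4 (+-monoˡ-≤ (2 * n) bound) ⟩
      M + 2 * n + 4                         ≤⟨ drop ⟩
      M′ + 4 * Q                            ≤⟨ +-monoʳ-≤ M′ (≤-trans (*-monoʳ-≤ 4 Q≤n) (m≤m+n _ 4)) ⟩
      M′ + (4 * n + 4)                      ∎))
      where
      open ≤-Reasoning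
      e₁ : ∀ S n D → 2 * S + 2 * (n * D) + (4 * n + 4) ≡ 2 * S + 2 * (n * suc D) + 2 * n + 4
      e₁ = solve-∀
    ... | inj₁ z with Q ≤? q (suc D) c
    -- The phase takes at most 2(n - Q) chips while n D falls by n; `drop` is the double of this,
    -- with 4 to spare.
    ...   | yes Q≤q = inj₂ (D , M′ , d , need , (begin
      2 * S c + 4 * n + 4 + 2 * (n * D)     ≡⟨ e₁ (S c) n D ⟩
      2 * S c + 2 * (n * suc D) + 2 * n + 4 ≤⟨ +-monoˡ-≤ 4 (+-monoˡ-≤ (2 * n) bound) ⟩
      M + 2 * n + 4                         ≤⟨ drop ⟩
      M′ + 4 * Q                            ≤⟨ +-monoʳ-≤ M′ (*-monoʳ-≤ 4 Q≤q) ⟩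
      M′ + 4 * q (suc D) c                  ∎))
      where
      open ≤-Reasoning
      e₁ : ∀ S n D → 2 * S + 4 * n + 4 + 2 * (n * D) ≡ 2 * S + 2 * (n * suc D) + 2 * n + 4
      e₁ = solve-∀
    -- With few edges short of the full deficit, `isoperimetry` bounds the chips directly. For k < Q
    -- and Q ≥ 3 one has k² - 3k ≤ Q² - 3Q, so `base`, stated for Q, covers every smaller k.
    ...   | no Q≰q with m≤n⇒∃[o]m+o≡n (<⇒≤ (≰⇒> Q≰q))
    ...     | e , refl = inj₂ (D , M′ , d , need , +-cancelʳ-≤ (3 * (k + e)) _ _ (begin
      2 * S c + 4 * n + 4 + 2 * (n * D) + 3 * (k + e)           ≡⟨ e₁ (S c) n D k e ⟩
      2 * S c + 2 * (n * suc D) + n + (n + 4 + 3 * k + 3 * e)   ≤⟨ +-monoˡ-≤ _ (isoperimetry (suc D) c need z) ⟩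
      k * k + k + n * n + (n + 4 + 3 * k + 3 * e)               ≤⟨ +-monoʳ-≤ (k * k + k + n * n) (+-monoʳ-≤ (n + 4 + 3 * k) (*-monoˡ-≤ e 3≤Q)) ⟩
      k * k + k + n * n + (n + 4 + 3 * k + (k + e) * e)         ≤⟨ m≤m+n _ (k * e) ⟩
      k * k + k + n * n + (n + 4 + 3 * k + (k + e) * e) + k * e ≡⟨ e₂ k n e ⟩
      n * n + (k + e) * (k + e) + n + 4 + 4 * k                 ≤⟨ +-monoˡ-≤ (4 * k) base ⟩
      M′ + 3 * (k + e) + 4 * k                                  ≡⟨ e₃ M′ k e ⟩
      M′ + 4 * k + 3 * (k + e)                                  ∎))
      where
      open ≤-Reasoning
      k : ℕ
      k = q (suc D) c
      e₁ : ∀ S n D k e → 2 * S + 4 * n + 4 + 2 * (n * D) + 3 * (k + e) ≡ 2 * S + 2 * (n * suc D) + n + (n + 4 + 3 * k + 3 * e)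
      e₁ = solve-∀
      e₂ : ∀ k n e → k * k + k + n * n + (n + 4 + 3 * k + (k + e) * e) + k * e ≡ n * n + (k + e) * (k + e) + n + 4 + 4 * k
      e₂ = solve-∀
      e₃ : ∀ M k e → M + 3 * (k + e) + 4 * k ≡ M + 4 * k + 3 * (k + e)
      e₃ = solve-∀

    -- `MinStrategy` wants the bound after every single chip, hence also in the middle of a phase; q
    -- ≤ n and `Descent-bound` give it.
    in-time : ∀ c v D {M} spare → 2 ≤ spare → Descent Θ D M →
              2 * S c + 4 * n + spare + 2 * (n * D) ≤ M + 4 * q (suc D) c → S (add c v) ≤ Θ
    in-time c v D {M} spare 2≤ d bound = subst (_≤ Θ) (sym (S-add c v)) (*-cancelˡ-≤ 2 (+-cancelʳ-≤ (4 * n + 2 * (n * D)) _ _ (begin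
      2 * suc (S c) + (4 * n + 2 * (n * D))     ≡⟨ e₁ (S c) n D ⟩
      2 * S c + 4 * n + 2 + 2 * (n * D)         ≤⟨ +-monoˡ-≤ (2 * (n * D)) (+-monoʳ-≤ (2 * S c + 4 * n) 2≤) ⟩
      2 * S c + 4 * n + spare + 2 * (n * D)     ≤⟨ bound ⟩
      M + 4 * q (suc D) c                       ≤⟨ +-mono-≤ (≤-trans (m≤m+n M 4) (Descent-bound d)) (*-monoʳ-≤ 4 (q≤n (suc D) c)) ⟩
      2 * Θ + 2 * (n * D) + 4 * n               ≡⟨ e₂ Θ n D ⟩
      2 * Θ + (4 * n + 2 * (n * D))             ∎)))
      where
      open ≤-Reasoning
      e₁ : ∀ S n D → 2 * suc S + (4 * n + 2 * (n * D)) ≡ 2 * S + 4 * n + 2 + 2 * (n * D)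
      e₁ = solve-∀
      e₂ : ∀ Θ n D → 2 * Θ + 2 * (n * D) + 4 * n ≡ 2 * Θ + (4 * n + 2 * (n * D))
      e₂ = solve-∀

    max-moves : ∀ c → Phase 4 c → ∀ v → S (add c v) ≤ Θ × (Over (add c v) ⊎ Phase 2 (add c v))
    max-moves c (D , M , d , need , bound) v = in-time c v D 4 (s≤s (s≤s z≤n)) d bound ,
      inj₂ (D , M , d , Need-add {suc D} c v need , (begin
      2 * S (add c v) + 4 * n + 2 + 2 * (n * D)  ≡⟨ cong (λ s → 2 * s + 4 * n + 2 + 2 * (n * D)) (S-add c v) ⟩
      2 * suc (S c) + 4 * n + 2 + 2 * (n * D)    ≡⟨ e₁ (S c) n (n * D) ⟩
      2 * S c + 4 * n + 4 + 2 * (n * D)          ≤⟨ bound ⟩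
      M + 4 * q (suc D) c                        ≤⟨ +-monoʳ-≤ M (*-monoʳ-≤ 4 (q-add (suc D) c v)) ⟩
      M + 4 * q (suc D) (add c v)                ∎))
      where
      open ≤-Reasoning
      e₁ : ∀ S n x → 2 * suc S + 4 * n + 2 + 2 * x ≡ 2 * S + 4 * n + 4 + 2 * x
      e₁ = solve-∀

    min-moves : ∀ c → Phase 2 c → ∃ λ v → S (add c v) ≤ Θ × (Over (add c v) ⊎ Phase 4 (add c v))
    min-moves c (D , M , d , need , bound) with zero? n (excess (suc D) c)
    -- Max has completed the phase himself, so Min's chip may go anywhere.
    ... | inj₂ pos = zero , in-time c zero D 2 ≤-refl d bound ,
      settle (add c zero) d (Need-add {D} c zero (tighten D c pos)) (+-cancelʳ-≤ (4 * n) _ _ (begin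
      2 * S (add c zero) + 2 * (n * D) + 4 * n   ≡⟨ cong (λ s → 2 * s + 2 * (n * D) + 4 * n) (S-add c zero) ⟩
      2 * suc (S c) + 2 * (n * D) + 4 * n        ≡⟨ e₁ (S c) n (n * D) ⟩
      2 * S c + 4 * n + 2 + 2 * (n * D)          ≤⟨ bound ⟩
      M + 4 * q (suc D) c                        ≤⟨ +-monoʳ-≤ M (*-monoʳ-≤ 4 (q≤n (suc D) c)) ⟩
      M + 4 * n                                  ∎))
      where
      open ≤-Reasoning
      e₁ : ∀ S n x → 2 * suc S + 2 * x + 4 * n ≡ 2 * S + 4 * n + 2 + 2 * x
      e₁ = solve-∀
    -- Edge r has the full deficit and edge r + 1 no larger one, so the counter increases between
    -- them and a token waits behind edge r.
    ... | inj₁ (r , r<n , e₀) with token-behind c r (+-cancelʳ-≤ (suc D) _ _ (begin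
      suc (N c r) + suc D        ≤⟨ s≤s (m∸n≡0⇒m≤n e₀) ⟩
      suc r                      ≤⟨ need (suc r) ⟩
      N c (suc r) + suc D        ∎))
      where open ≤-Reasoning
    ...   | v , bumped = v , in-time c v D 2 ≤-refl d bound ,
      inj₂ (D , M , d , Need-add {suc D} c v need , (begin
      2 * S (add c v) + 4 * n + 4 + 2 * (n * D)  ≡⟨ cong (λ s → 2 * s + 4 * n + 4 + 2 * (n * D)) (S-add c v) ⟩
      2 * suc (S c) + 4 * n + 4 + 2 * (n * D)    ≡⟨ e₁ (S c) n (n * D) ⟩
      2 * S c + 4 * n + 2 + 2 * (n * D) + 4      ≤⟨ +-monoˡ-≤ 4 bound ⟩
      M + 4 * q (suc D) c + 4                    ≡⟨ e₂ M (q (suc D) c) ⟩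
      M + 4 * suc (q (suc D) c)                  ≤⟨ +-monoʳ-≤ M (*-monoʳ-≤ 4 more) ⟩
      M + 4 * q (suc D) (add c v)                ∎))
      where
      open ≤-Reasoning
      e₁ : ∀ S n x → 2 * suc S + 4 * n + 4 + 2 * x ≡ 2 * S + 4 * n + 2 + 2 * x + 4
      e₁ = solve-∀
      e₂ : ∀ M q → M + 4 * q + 4 ≡ M + 4 * suc q
      e₂ = solve-∀
      now-positive : 1 ≤ excess (suc D) (add c v) r
      now-positive = m<n⇒0<n∸m (≤-trans (s≤s (need r)) (≤-reflexive (cong (_+ suc D) (sym bumped))))
      more : q (suc D) c < q (suc D) (add c v)
      more = sumTo-strict n r r<n (subst (λ x → sgn x < sgn (excess (suc D) (add c v) r)) (sym e₀) (sgn-mono now-positive))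
        λ j _ → sgn-mono (excess-add (suc D) c v j)

    open MinStrategy Θ (Phase 4) (Phase 2) max-moves min-moves

    upper-bound : ∀ {M k} → 0 < p → Descent Θ p M → 2 * (n * p) ≤ M → Val Max empty k → k ≤ Θ
    upper-bound {M} {k} 0<p d start val with settle empty d (periodic-≤ empty p λ r r<n → ≤-trans (s≤s⁻¹ r<n) (m≤n+m p _))
                                  (subst (λ s → 2 * s + 2 * (n * p) ≤ M) (sym S-empty) start)
    ... | inj₂ phase = subst (_≤ Θ) (trans (cong (k +_) S-empty) (+-identityʳ k)) (value≤ (same λ _ → refl) phase val)
    ... | inj₁ over  = ⊥-elim (Over⇒unstable {empty} over λ v → subst (0 <_) (sym (deg≡p v)) 0<p)

-- Lower bound: Max raises the surplus of an edge.

sumTo-≤suc : ∀ m i {f g} → i < m → f i ≤ suc (g i) → (∀ j → j < m → j ≢ i → f j ≤ g j) →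
             sumTo m f ≤ suc (sumTo m g)
sumTo-≤suc (suc m) zero    _         le h = +-mono-≤ le (sumTo-mono m λ j j<m → h (suc j) (s<s j<m) λ ())
sumTo-≤suc (suc m) (suc i) {f} {g} (s<s i<m) le h = ≤-trans
  (+-mono-≤ (h 0 z<s λ ()) (sumTo-≤suc m i i<m le λ j j<m j≢i → h (suc j) (s<s j<m) (j≢i ∘ suc-injective)))
  (≤-reflexive (+-suc (g 0) _))

crossing : ∀ m (h : ℕ → ℕ) g → h 0 < g → g ≤ h m → ∃ λ i → i < m × h i < g × g ≤ h (suc i)
crossing zero    h g lt ge = ⊥-elim (<⇒≱ lt ge)
crossing (suc m) h g lt ge with g ≤? h m
... | no ¬le = m , ≤-refl , ≰⇒> ¬le , ge
... | yes le with crossing m h g lt le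
...   | i , i<m , rest = i , m<n⇒m<1+n i<m , rest

threshold : ∀ m (h : ℕ → ℕ) a → (∀ i → h i ≤ h (suc i)) →
            ∃ λ u → u ≤ m × (∀ i → i < u → h i ≤ a) × (∀ i → u ≤ i → i < m → a < h i)
threshold zero    h a mono = 0 , z≤n , (λ _ ()) , λ _ _ ()
threshold (suc m) h a mono with h 0 ≤? a
... | no ¬le = 0 , z≤n , (λ _ ()) , λ i _ _ → <-≤-trans (≰⇒> ¬le) (from0 i)
  where
  from0 : ∀ i → h 0 ≤ h i
  from0 zero    = ≤-refl
  from0 (suc i) = ≤-trans (from0 i) (mono i)
... | yes le with threshold m (h ∘ suc) a (mono ∘ suc)
...   | u , u≤m , below , above = suc u , s≤s u≤m ,
  (λ { zero _ → le ; (suc i) (s<s i<u) → below i i<u }) ,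
  λ { (suc i) (s≤s u≤i) (s<s i<m) → above i u≤i i<m }

sumTo-sgn∸ : ∀ v m → sumTo m (λ i → sgn (i ∸ v)) ≡ m ∸ suc v
sumTo-sgn∸ v zero    = refl
sumTo-sgn∸ v (suc m) = trans (sumTo-snoc m _) (trans (cong (_+ sgn (m ∸ v)) (sumTo-sgn∸ v m)) (last m v))
  where
  last : ∀ m v → m ∸ suc v + sgn (m ∸ v) ≡ m ∸ v
  last zero    zero    = refl
  last zero    (suc v) = refl
  last (suc m) zero    = +-comm m 1
  last (suc m) (suc v) = last m v

2*sumTo-∸ : ∀ v → 2 * sumTo v (v ∸_) ≡ v * v + v
2*sumTo-∸ zero    = refl
2*sumTo-∸ (suc v) = trans (*-distribˡ-+ 2 (suc v) _) (trans (cong (2 * suc v +_) (2*sumTo-∸ v)) (square v))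
  where
  square : ∀ v → 2 * suc v + (v * v + v) ≡ suc v * suc v + suc v
  square = solve-∀

module Lower (p : ℕ) where
  open Complete p
  open Upper p using (N≤N-add)

  -- A lower bound for the deficit when N takes a minimal value on κ consecutive edges
  -- of which the first has surplus v, and stays within n ∸ κ of that value elsewhere.
  pool : ℕ → ℕ → ℕ
  pool κ v = sumTo κ (λ i → i ∸ v) + sumTo (n ∸ κ) (λ j → (κ + j) ∸ (v + (n ∸ κ)))

  -- ρ is a lower bound for the deficit left when some edge has reached surplus v.
  data Ascent (v* : ℕ) : ℕ → ℕ → Set where
    end  : ∀ {v ρ} → v* ≤ v → Ascent v* v ρ
    step : ∀ {v ρ} κ ρ′ → 1 ≤ ρ′ → ρ′ + (κ ∸ suc v + κ) ≤ ρ →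
           (κ < n → ρ′ + (n + n) ≤ pool κ v) → Ascent v* (suc v) ρ′ → Ascent v* v ρ

  -- Max's lifeline: while it is positive the game is not over, and a chip lowers it by at most one.
  deficit : Config → ℕ
  deficit c = sumTo n λ r → r ∸ N c r

  -- g is the level wanted at edge b, and by monotonicity all later edges must reach it too. A chip
  -- across edge b + i lowers the deficit only if the counter is also below b + i, hence the
  -- minimum.
  cost useful : ℕ → ℕ → Config → ℕ
  cost b g c = sumTo n λ i → g ∸ N c (b + i)
  useful b g c = sumTo n λ i → g ⊓ (b + i) ∸ N c (b + i)

  deficit-from : ∀ c b → sumTo n (λ i → (b + i) ∸ N c (b + i)) ≡ deficit c
  deficit-from c b = sumTo-rotate n b (λ r → r ∸ N c r) λ r →
    trans (cong₂ _∸_ (+-comm r n) (trans (N-period c r) (+-comm (N c r) n))) ([m+n]∸[m+o]≡n∸o n r (N c r))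

  N-mono-≤ : ∀ c {r s} → r ≤ s → N c r ≤ N c s
  N-mono-≤ c {r} r≤s with m≤n⇒∃[o]m+o≡n r≤s
  ... | k , refl = go k
    where
    go : ∀ k → N c r ≤ N c (r + k)
    go zero    = ≤-reflexive (cong (N c) (sym (+-identityʳ r)))
    go (suc k) = ≤-trans (go k) (subst (λ x → N c (r + k) ≤ N c x) (sym (+-suc r k)) (N-mono c (r + k)))

  deficit-add : ∀ c v → deficit c ≤ suc (deficit (add c v))
  deficit-add c v with add-bump c v 0
  ... | i , i<n , at , off = sumTo-≤suc n i i<n
    (subst (λ x → i ∸ N c i ≤ suc (i ∸ x)) (sym at) (pred∸ i (N c i)))
    λ j j<n j≢i → ≤-reflexive (cong (j ∸_) (sym (off j j<n j≢i)))
    where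
    pred∸ : ∀ x y → x ∸ y ≤ suc (x ∸ suc y)
    pred∸ zero    zero    = z≤n
    pred∸ zero    (suc y) = z≤n
    pred∸ (suc x) zero    = ≤-refl
    pred∸ (suc x) (suc y) = pred∸ x y

  cost-add : ∀ b g c v → cost b g (add c v) ≤ cost b g c
  cost-add b g c v = sumTo-mono n λ i _ → ∸-monoʳ-≤ g (N≤N-add c v (b + i))

  useful-add : ∀ b g c v → useful b g (add c v) ≤ useful b g c
  useful-add b g c v = sumTo-mono n λ i _ → ∸-monoʳ-≤ (g ⊓ (b + i)) (N≤N-add c v (b + i))

  module Play (Θ v* : ℕ) (v*≤n : v* ≤ n) (Θ-small : 2 * Θ + n ≤ n * n + (v* * v* + v*)) where

    -- Counters never decrease, so this cannot be lost and Max may then play anywhere.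
    Final : Config → Set
    Final c = ∃ λ b → b + v* ≤ N c b

    -- Max is raising the surplus of edge b to v; cost counts the chips this still takes,
    -- and useful those of them which reduce the deficit.
    Filling : ℕ → ℕ → ℕ → Config → Set
    Filling spare b v c = ∃ λ ρ → Ascent v* v ρ × 1 ≤ ρ × b + v ≤ N c b + n ×
      ρ + (useful b (b + v) c + cost b (b + v) c) + spare ≤ deficit c

    QMax QMin : Config → Set
    QMax c = Final c ⊎ ∃ λ b → ∃ λ v → N c b < b + v × Filling 0 b v c
    QMin c = Final c ⊎ ∃ λ b → ∃ λ v → Filling 1 b v c

    settle : ∀ {v ρ} c b → Ascent v* v ρ → b + v ≤ N c b → ρ ≤ deficit c → QMax c
    settle c b (end v*≤v) reached _ = inj₁ (b , ≤-trans (+-monoʳ-≤ b v*≤v) reached)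
    -- The candidates for the next unit are b (`top`) and its predecessor on the cycle (`floor`),
    -- written b + p to stay a period ahead. If either already has it, the recursion advances for
    -- free.
    settle {v} {ρ} c b (step κ ρ′ 1≤ρ′ drop large next) reached rest with b + suc v ≤? N c b | b + p + suc v ≤? N c (b + p)
    ... | yes top | _ = settle c b next top (≤-trans (≤-trans (m≤m+n ρ′ _) drop) rest)
    ... | no _ | yes floor = settle c (b + p) next floor (≤-trans (≤-trans (m≤m+n ρ′ _) drop) rest)
    -- Raising b means lifting the whole plateau of u edges at level a; raising b₁ takes y chips
    -- across that one edge.
    ... | no ¬top | no ¬floor = decide (threshold n (λ i → N c (b + i)) a (λ i → N-mono-≤ c (+-monoʳ-≤ b (n≤1+n i))))
      where
      open ≤-Reasoning
      a b₁ y : ℕ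
      a  = b + v
      b₁ = b + p
      y  = b₁ + suc v ∸ N c b₁
      Nb≡a : N c b ≡ a
      Nb≡a = ≤-antisym (s≤s⁻¹ (subst (N c b <_) (+-suc b v) (≰⇒> ¬top))) reached
      a≤N : ∀ i → a ≤ N c (b + i)
      a≤N i = ≤-trans reached (N-mono-≤ c (m≤m+n b i))
      level₁ : b₁ + suc v ≡ a + n
      level₁ = shuffle b p v
        where
        shuffle : ∀ b p v → b + p + suc v ≡ b + v + suc p
        shuffle = solve-∀
      Nb₁+y : N c b₁ + y ≡ a + n
      Nb₁+y = trans (m+[n∸m]≡n (<⇒≤ (≰⇒> ¬floor))) level₁
      wrapped : ∀ i → 1 ≤ i → a + n ≤ N c (b₁ + i)
      wrapped (suc i) _ = ≤-trans (≤-reflexive (trans (cong (_+ n) (sym Nb≡a)) (sym (N-period c b))))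
        (N-mono-≤ c (≤-trans (≤-reflexive (sym (trans (+-assoc b p 1) (cong (b +_) (+-comm p 1))))) (+-monoʳ-≤ b₁ (s≤s z≤n))))

      bounds : ∀ {x k} → k ≤ κ → x ≤ (k ∸ suc v) + k → ρ′ + x + 0 ≤ deficit c
      bounds {x} {k} k≤κ x≤ = begin
        ρ′ + x + 0                  ≡⟨ +-identityʳ _ ⟩
        ρ′ + x                      ≤⟨ +-monoʳ-≤ ρ′ (≤-trans x≤ (+-mono-≤ (∸-monoˡ-≤ (suc v) k≤κ) k≤κ)) ⟩
        ρ′ + (κ ∸ suc v + κ)        ≤⟨ drop ⟩
        ρ                           ≤⟨ rest ⟩
        deficit c                   ∎

      -- Edges after b₁ lie a period beyond b and so have reached a + n already; only b₁ itself
      -- contributes.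
      floor-cost : useful b₁ (b₁ + suc v) c + cost b₁ (b₁ + suc v) c ≤ (y ∸ suc v) + y
      floor-cost = +-mono-≤
        (≤-trans (+-mono-≤ (≤-reflexive first) (≤-reflexive (later (λ i → (b₁ + suc v) ⊓ (b₁ + i)) λ i → m⊓n≤m _ _))) (≤-reflexive (+-identityʳ _)))
        (≤-trans (+-mono-≤ (≤-reflexive (cong (λ x → b₁ + suc v ∸ N c x) (+-identityʳ b₁))) (≤-reflexive (later (λ _ → b₁ + suc v) λ _ → ≤-refl))) (≤-reflexive (+-identityʳ _)))
        where
        later : ∀ (h : ℕ → ℕ) → (∀ i → h i ≤ b₁ + suc v) → sumTo p (λ i → h (suc i) ∸ N c (b₁ + suc i)) ≡ 0
        later h h≤ = trans (sumTo-cong p λ i _ → m≤n⇒m∸n≡0 (≤-trans (h≤ (suc i)) (≤-trans (≤-reflexive level₁) (wrapped (suc i) (s≤s z≤n)))))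
          (trans (sumTo-const p 0) (*-zeroʳ p))
        first : (b₁ + suc v) ⊓ (b₁ + 0) ∸ N c (b₁ + 0) ≡ y ∸ suc v
        first = begin-equality
          (b₁ + suc v) ⊓ (b₁ + 0) ∸ N c (b₁ + 0)  ≡⟨ cong (_∸ N c (b₁ + 0)) (m≥n⇒m⊓n≡n (+-monoʳ-≤ b₁ z≤n)) ⟩
          b₁ + 0 ∸ N c (b₁ + 0)                   ≡⟨ cong (λ x → x ∸ N c x) (+-identityʳ b₁) ⟩
          b₁ ∸ N c b₁                             ≡⟨ cong (_∸ N c b₁) (m+n∸n≡m b₁ (suc v)) ⟨
          b₁ + suc v ∸ suc v ∸ N c b₁             ≡⟨ ∸-+-assoc (b₁ + suc v) (suc v) (N c b₁) ⟩
          b₁ + suc v ∸ (suc v + N c b₁)           ≡⟨ cong (b₁ + suc v ∸_) (+-comm (suc v) (N c b₁)) ⟩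
          b₁ + suc v ∸ (N c b₁ + suc v)           ≡⟨ ∸-+-assoc (b₁ + suc v) (N c b₁) (suc v) ⟨
          y ∸ suc v                               ∎

      g≡1+a : b + suc v ≡ suc a
      g≡1+a = +-suc b v

      -- Each of the first u edges misses the target by at most one, and level b + v is below b + i
      -- only for i > v.
      top-cost : ∀ {u} → u ≤ n → (∀ i → u ≤ i → i < n → a < N c (b + i)) →
                 useful b (b + suc v) c + cost b (b + suc v) c ≤ (u ∸ suc v) + u
      top-cost {u} u≤n above = +-mono-≤
        (≤-trans (prefix (λ i → (b + suc v) ⊓ (b + i)) (λ i → m⊓n≤m _ _) (λ i → sgn (i ∸ v)) one-useful) (≤-reflexive (sumTo-sgn∸ v u)))
        (≤-trans (prefix (λ _ → b + suc v) (λ _ → ≤-refl) (λ _ → 1) λ i → ≤-trans (∸-monoʳ-≤ (b + suc v) (a≤N i))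
          (≤-reflexive (trans (cong (_∸ a) g≡1+a) (m+n∸n≡m 1 a)))) (≤-reflexive (trans (sumTo-const u 1) (*-identityʳ u))))
        where
        prefix : ∀ (h : ℕ → ℕ) → (∀ i → h i ≤ b + suc v) → (k : ℕ → ℕ) → (∀ i → h i ∸ N c (b + i) ≤ k i) →
                 sumTo n (λ i → h i ∸ N c (b + i)) ≤ sumTo u k
        prefix h h≤ k small = begin
          sumTo n f                                              ≡⟨ cong (λ m → sumTo m f) (m+[n∸m]≡n u≤n) ⟨
          sumTo (u + (n ∸ u)) f                                  ≡⟨ sumTo-append u (n ∸ u) f ⟩
          sumTo u f + sumTo (n ∸ u) (λ i → f (u + i))            ≤⟨ +-mono-≤ (sumTo-mono u λ i _ → small i) (≤-reflexive none) ⟩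
          sumTo u k + 0                                          ≡⟨ +-identityʳ _ ⟩
          sumTo u k                                              ∎
          where
          f : ℕ → ℕ
          f i = h i ∸ N c (b + i)
          none : sumTo (n ∸ u) (λ i → f (u + i)) ≡ 0
          none = trans (sumTo-cong (n ∸ u) λ i i< → m≤n⇒m∸n≡0 (≤-trans (h≤ (u + i)) (≤-trans (≤-reflexive g≡1+a)
              (above (u + i) (m≤m+n u i) (subst (u + i <_) (m+[n∸m]≡n u≤n) (+-monoʳ-< u i<))))))
            (trans (sumTo-const (n ∸ u) 0) (*-zeroʳ (n ∸ u)))
        one-useful : ∀ i → (b + suc v) ⊓ (b + i) ∸ N c (b + i) ≤ sgn (i ∸ v)
        one-useful i = ≤-trans (∸-monoʳ-≤ ((b + suc v) ⊓ (b + i)) (a≤N i)) (≤-trans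
          (≤-reflexive (trans (cong (_∸ a) (sym (+-distribˡ-⊓ b (suc v) i))) ([m+n]∸[m+o]≡n∸o b (suc v ⊓ i) v))) (small v i))
          where
          small : ∀ v i → suc v ⊓ i ∸ v ≤ sgn (i ∸ v)
          small zero    zero    = z≤n
          small zero    (suc i) = ≤-refl
          small (suc v) zero    = z≤n
          small (suc v) (suc i) = small v i

      -- The plateau keeps the first κ edges at level a, and the low counter of b₁, the last edge of
      -- the window, caps all the others.
      pool≤deficit : ∀ {u} → u ≤ n → (∀ i → i < u → N c (b + i) ≤ a) → κ < u → κ < y → pool κ v ≤ deficit c
      pool≤deficit {u} u≤n flat κ<u κ<y = begin
        pool κ v                                                ≤⟨ +-mono-≤ (sumTo-mono κ λ i i<κ → low i i<κ) (sumTo-mono (n ∸ κ) λ j j< → high j j<) ⟩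
        sumTo κ f + sumTo (n ∸ κ) (λ j → f (κ + j))             ≡⟨ sumTo-append κ (n ∸ κ) f ⟨
        sumTo (κ + (n ∸ κ)) f                                   ≡⟨ cong (λ m → sumTo m f) (m+[n∸m]≡n κ≤n) ⟩
        sumTo n f                                               ≡⟨ deficit-from c b ⟩
        deficit c                                               ∎
        where
        κ≤n : κ ≤ n
        κ≤n = ≤-trans (<⇒≤ κ<u) u≤n
        f : ℕ → ℕ
        f i = (b + i) ∸ N c (b + i)
        low : ∀ i → i < κ → i ∸ v ≤ f i
        low i i<κ = ≤-trans (≤-reflexive (sym ([m+n]∸[m+o]≡n∸o b i v))) (∸-monoʳ-≤ (b + i) (flat i (<-trans i<κ κ<u)))
        cap : N c b₁ ≤ b + (v + (n ∸ κ))
        cap = +-cancelʳ-≤ κ _ _ (begin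
          N c b₁ + κ                   ≤⟨ +-monoʳ-≤ (N c b₁) (<⇒≤ κ<y) ⟩
          N c b₁ + y                   ≡⟨ Nb₁+y ⟩
          b + v + n                    ≡⟨ cong (b + v +_) (m∸n+n≡m κ≤n) ⟨
          b + v + (n ∸ κ + κ)          ≡⟨ regroup b v (n ∸ κ) κ ⟩
          b + (v + (n ∸ κ)) + κ        ∎)
          where
          regroup : ∀ b v x k → b + v + (x + k) ≡ b + (v + x) + k
          regroup = solve-∀
        high : ∀ j → j < n ∸ κ → (κ + j) ∸ (v + (n ∸ κ)) ≤ f (κ + j)
        high j j< = ≤-trans (≤-reflexive (sym ([m+n]∸[m+o]≡n∸o b (κ + j) (v + (n ∸ κ)))))
          (∸-monoʳ-≤ (b + (κ + j)) (≤-trans (N-mono-≤ c (+-monoʳ-≤ b (s≤s⁻¹ (subst (κ + j <_) (m+[n∸m]≡n κ≤n) (+-monoʳ-< κ j<))))) cap))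

      decide : (∃ λ u → u ≤ n × (∀ i → i < u → N c (b + i) ≤ a) × (∀ i → u ≤ i → i < n → a < N c (b + i))) → QMax c
      decide (u , u≤n , flat , above) = choose (u ≤? κ) (y ≤? κ)
        where
        raise-top : ρ′ + (useful b (b + suc v) c + cost b (b + suc v) c) + 0 ≤ deficit c → QMax c
        raise-top bound = inj₂ (b , suc v , ≰⇒> ¬top , ρ′ , next , 1≤ρ′ ,
          subst₂ _≤_ (sym g≡1+a) (cong (_+ n) (sym Nb≡a)) (subst (_≤ a + n) (+-comm a 1) (+-monoʳ-≤ a (s≤s z≤n))) , bound)
        choose : Dec (u ≤ κ) → Dec (y ≤ κ) → QMax c
        choose (yes u≤κ) _         = raise-top (bounds u≤κ (top-cost u≤n above))
        choose (no _)    (yes y≤κ) = inj₂ (b₁ , suc v , ≰⇒> ¬floor , ρ′ , next , 1≤ρ′ ,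
          ≤-trans (≤-reflexive level₁) (+-monoˡ-≤ n (a≤N p)) , bounds y≤κ floor-cost)
        -- Both candidates are dear, but then the deficit is at least `pool κ v`, which even pays
        -- for the crude price 2n of raising b.
        choose (no u≰κ)  (no y≰κ)  = raise-top (≤-trans (≤-reflexive (+-identityʳ _))
          (≤-trans (+-monoʳ-≤ ρ′ (≤-trans (top-cost u≤n above) (+-mono-≤ (≤-trans (m∸n≤m u (suc v)) u≤n) u≤n)))
          (≤-trans (large (<-≤-trans (≰⇒> u≰κ) u≤n)) (pool≤deficit u≤n flat (≰⇒> u≰κ) (≰⇒> y≰κ)))))

    -- Max crosses an edge below the target whose successor has reached it, so a token waits there.
    -- It exists within one period because b + v is at most `N c (b + n)`.
    max-moves : ∀ c → QMax c → ∃ λ v → QMin (add c v)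
    max-moves c (inj₁ (b , high)) = zero , inj₁ (b , ≤-trans high (N≤N-add c zero b))
    max-moves c (inj₂ (b , v , low , ρ , asc , 1≤ρ , close , bound))
      with crossing n (λ i → N c (b + i)) (b + v) (subst (λ x → N c x < b + v) (sym (+-identityʳ b)) low)
             (≤-trans close (≤-reflexive (sym (N-period c b))))
    ... | i , i<n , below , reached with token-behind c (b + i) (<-≤-trans below (subst (λ x → b + v ≤ N c x) (+-suc b i) reached))
    ...   | w , bumped = w , inj₂ (b , v , ρ , asc , 1≤ρ , ≤-trans close (+-monoˡ-≤ n (N≤N-add c w b)) , spend (N c (b + i) <? b + i))
      where
      open ≤-Reasoning
      g : ℕ
      g = b + v
      drop : ∀ h → N c (b + i) < h → h ∸ N (add c w) (b + i) < h ∸ N c (b + i)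
      drop h lt = ≤-reflexive (trans (cong (λ x → suc (h ∸ x)) bumped) (sym (+-∸-assoc 1 lt)))
      cheaper : cost b g (add c w) < cost b g c
      cheaper = sumTo-strict n i i<n (drop g below) λ j _ → ∸-monoʳ-≤ g (N≤N-add c w (b + j))
      -- Below b + i, `useful` and `cost` both fall, paying for the loss of deficit and for Min's
      -- reply. Otherwise the deficit stays, and the fall of `cost` pays for the reply.
      spend : Dec (N c (b + i) < b + i) → ρ + (useful b g (add c w) + cost b g (add c w)) + 1 ≤ deficit (add c w)
      spend (yes lt) = s≤s⁻¹ (begin
        suc (ρ + (useful b g (add c w) + cost b g (add c w)) + 1)       ≡⟨ regroup ρ (useful b g (add c w)) (cost b g (add c w)) ⟩
        ρ + (suc (useful b g (add c w)) + suc (cost b g (add c w))) + 0 ≤⟨ +-monoˡ-≤ 0 (+-monoʳ-≤ ρ (+-mono-≤ less-useful cheaper)) ⟩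
        ρ + (useful b g c + cost b g c) + 0                             ≤⟨ bound ⟩
        deficit c                                                       ≤⟨ deficit-add c w ⟩
        suc (deficit (add c w))                                         ∎)
        where
        regroup : ∀ r u k → suc (r + (u + k) + 1) ≡ r + (suc u + suc k) + 0
        regroup = solve-∀
        less-useful : useful b g (add c w) < useful b g c
        less-useful = sumTo-strict n i i<n (drop (g ⊓ (b + i)) (⊓-glb below lt)) λ j _ → ∸-monoʳ-≤ (g ⊓ (b + j)) (N≤N-add c w (b + j))
      spend (no ¬lt) = begin
        ρ + (useful b g (add c w) + cost b g (add c w)) + 1   ≡⟨ regroup ρ (useful b g (add c w)) (cost b g (add c w)) ⟩
        ρ + (useful b g (add c w) + suc (cost b g (add c w))) + 0 ≤⟨ +-monoˡ-≤ 0 (+-monoʳ-≤ ρ (+-mono-≤ (useful-add b g c w) cheaper)) ⟩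
        ρ + (useful b g c + cost b g c) + 0                   ≤⟨ bound ⟩
        deficit c                                             ≡⟨ deficit-from c b ⟨
        sumTo n (λ j → (b + j) ∸ N c (b + j))                 ≤⟨ sumTo-mono n unchanged ⟩
        sumTo n (λ j → (b + j) ∸ N (add c w) (b + j))         ≡⟨ deficit-from (add c w) b ⟩
        deficit (add c w)                                     ∎
        where
        regroup : ∀ r u k → r + (u + k) + 1 ≡ r + (u + suc k) + 0
        regroup = solve-∀
        unchanged : ∀ j → j < n → (b + j) ∸ N c (b + j) ≤ (b + j) ∸ N (add c w) (b + j)
        unchanged j j<n with add-bump c w b
        ... | i′ , _ , _ , off with j ≟ i
        ...   | yes refl = ≤-trans (≤-reflexive (m≤n⇒m∸n≡0 (≮⇒≥ ¬lt))) z≤n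
        ...   | no j≢i with i ≟ i′
        ...     | yes refl = ≤-reflexive (cong (b + j ∸_) (sym (off j j<n j≢i)))
        ...     | no i≢i′  = ⊥-elim (1+n≢n (trans (sym bumped) (off i i<n i≢i′)))

    min-moves : ∀ c → QMin c → ∀ w → QMax (add c w)
    min-moves c (inj₁ (b , high)) w = inj₁ (b , ≤-trans high (N≤N-add c w b))
    min-moves c (inj₂ (b , v , ρ , asc , 1≤ρ , close , bound)) w with N (add c w) b <? b + v
    ... | yes low = inj₂ (b , v , low , ρ , asc , 1≤ρ , ≤-trans close (+-monoˡ-≤ n (N≤N-add c w b)) , left)
      where
      left : ρ + (useful b (b + v) (add c w) + cost b (b + v) (add c w)) + 0 ≤ deficit (add c w)
      left = s≤s⁻¹ (≤-trans (≤-reflexive (trans (cong suc (+-identityʳ _)) (+-comm 1 _)))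
        (≤-trans (+-monoˡ-≤ 1 (+-monoʳ-≤ ρ (+-mono-≤ (useful-add b (b + v) c w) (cost-add b (b + v) c w)))) (≤-trans bound (deficit-add c w))))
    ... | no ¬low = settle (add c w) b asc (≮⇒≥ ¬low)
      (s≤s⁻¹ (≤-trans (≤-trans (≤-reflexive (+-comm 1 ρ)) (+-monoˡ-≤ 1 (m≤m+n ρ _))) (≤-trans bound (deficit-add c w))))

    Over⇒no-deficit : ∀ c → Over c → deficit c ≡ 0
    Over⇒no-deficit c over = trans (sumTo-cong n λ r _ → m≤n⇒m∸n≡0 (over r)) (trans (sumTo-const n 0) (*-zeroʳ n))

    -- Monotone counters leave a surplus of at least v* - i at edge b + i, and when the game is over
    -- no other edge makes up for it by a deficit.
    final-over : ∀ c → Final c → Over c → Θ ≤ S c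
    final-over c (b , high) over = *-cancelˡ-≤ 2 (+-cancelʳ-≤ n _ _ (begin
      2 * Θ + n                                              ≤⟨ Θ-small ⟩
      n * n + (v* * v* + v*)                                 ≡⟨ cong₂ _+_ (2*sumTo-id n) (2*sumTo-∸ v*) ⟨
      2 * sumTo n id + n + 2 * sumTo v* (v* ∸_)              ≤⟨ +-monoʳ-≤ (2 * sumTo n id + n) (*-monoʳ-≤ 2 surplus) ⟩
      2 * sumTo n id + n + 2 * sumTo n (λ r → N c r ∸ r)     ≡⟨ regroup (sumTo n id) n (sumTo n (λ r → N c r ∸ r)) ⟩
      2 * (sumTo n (λ r → N c r ∸ r) + sumTo n id) + n       ≡⟨ cong (λ x → 2 * x + n) total ⟩
      2 * S c + n                                            ∎))
      where
      open ≤-Reasoning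
      regroup : ∀ s n w → 2 * s + n + 2 * w ≡ 2 * (w + s) + n
      regroup = solve-∀
      total : sumTo n (λ r → N c r ∸ r) + sumTo n id ≡ S c
      total = trans (sym (sumTo-+ n (λ r → N c r ∸ r) id)) (sumTo-cong n λ r _ → m∸n+n≡m (over r))
      surplus : sumTo v* (v* ∸_) ≤ sumTo n (λ r → N c r ∸ r)
      surplus = begin
        sumTo v* (v* ∸_)                             ≤⟨ sumTo-mono v* (λ i _ → ≤-trans (≤-reflexive (sym ([m+n]∸[m+o]≡n∸o b v* i)))
                                                          (∸-monoˡ-≤ (b + i) (≤-trans high (N-mono-≤ c (m≤m+n b i))))) ⟩
        sumTo v* f                                   ≤⟨ m≤m+n _ _ ⟩
        sumTo v* f + sumTo (n ∸ v*) (λ i → f (v* + i)) ≡⟨ sumTo-append v* (n ∸ v*) f ⟨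
        sumTo (v* + (n ∸ v*)) f                      ≡⟨ cong (λ m → sumTo m f) (m+[n∸m]≡n v*≤n) ⟩
        sumTo n f                                    ≡⟨ sumTo-rotate n b (λ r → N c r ∸ r) (λ r →
                                                          trans (cong₂ _∸_ (trans (N-period c r) (+-comm (N c r) n)) (+-comm r n)) ([m+n]∸[m+o]≡n∸o n (N c r) r)) ⟩
        sumTo n (λ r → N c r ∸ r)                    ∎
        where
        f : ℕ → ℕ
        f i = N c (b + i) ∸ (b + i)

    filling-not-over : ∀ {spare b v} c → Filling spare b v c → Over c → Θ ≤ S c
    filling-not-over c (ρ , _ , 1≤ρ , _ , bound) over = ⊥-elim (<⇒≱ 1≤ρ
      (≤-trans (≤-trans (m≤m+n ρ _) (m≤m+n _ _)) (≤-trans bound (≤-reflexive (Over⇒no-deficit c over)))))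

    max-over : ∀ c → QMax c → Over c → Θ ≤ S c
    max-over c (inj₁ final)             = final-over c final
    max-over c (inj₂ (b , v , _ , fil)) = filling-not-over {0} {b} {v} c fil

    min-over : ∀ c → QMin c → Over c → Θ ≤ S c
    min-over c (inj₁ final)         = final-over c final
    min-over c (inj₂ (b , v , fil)) = filling-not-over {1} {b} {v} c fil

    open MaxStrategy Θ QMax QMin max-moves min-moves max-over min-over

    lower-bound : ∀ {ρ k} → Ascent v* 0 ρ → 2 * ρ + n ≤ n * n → Val Max empty k → Θ ≤ k
    lower-bound {ρ} {k} asc ρ-small val = subst (Θ ≤_) (trans (cong (k +_) S-empty) (+-identityʳ k))
      (≤value (same λ _ → refl) (settle empty 0 asc z≤n enough) val)
      where
      open ≤-Reasoning
      N-empty : ∀ r → r < n → N empty r ≡ 0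
      N-empty r r<n = trans (∑-cong {n} {λ _ → r / n} {λ _ → 0} λ _ → m<n⇒m/n≡0 r<n) (∑-0 n)
      enough : ρ ≤ deficit empty
      enough = *-cancelˡ-≤ 2 (+-cancelʳ-≤ n _ _ (begin
        2 * ρ + n                ≤⟨ ρ-small ⟩
        n * n                    ≡⟨ 2*sumTo-id n ⟨
        2 * sumTo n id + n       ≡⟨ cong (λ x → 2 * x + n) (sumTo-cong n λ r r<n → cong (r ∸_) (N-empty r r<n)) ⟨
        2 * deficit empty + n    ∎))

-- Passing to units of n / U and absorbing lower-order terms.

module Scale (p a b U : ℕ) (n≡ : suc p ≡ U * a + b) (b≤U : b ≤ U) (a-large : 6 * (U * U) + 6 ≤ a) where
  open Complete p using (n)

  U≤U² : U ≤ U * U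
  U≤U² = x≤x² U
    where
    x≤x² : ∀ x → x ≤ x * x
    x≤x² zero    = z≤n
    x≤x² (suc x) = m≤m+n (suc x) _

  6U+6≤a : 6 * U + 6 ≤ a
  6U+6≤a = ≤-trans (+-monoˡ-≤ 6 (*-monoʳ-≤ 6 U≤U²)) a-large

  b+b≤a : b + b ≤ a
  b+b≤a = ≤-trans (+-mono-≤ b≤U b≤U) (≤-trans (≤-trans (+-monoʳ-≤ U (m≤m+n U (4 * U))) (m≤m+n _ 6)) 6U+6≤a)

  b≤a : b ≤ a
  b≤a = ≤-trans (m≤m+n b b) b+b≤a

  1≤a : 1 ≤ a
  1≤a = ≤-trans (≤-trans (s≤s z≤n) (m≤n+m 6 (6 * U))) 6U+6≤a

  6n≤a² : 6 * n ≤ a * a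
  6n≤a² = begin
    6 * n                  ≡⟨ cong (6 *_) n≡ ⟩
    6 * (U * a + b)        ≤⟨ *-monoʳ-≤ 6 (+-monoʳ-≤ (U * a) b≤a) ⟩
    6 * (U * a + a)        ≡⟨ e U a ⟩
    (6 * U + 6) * a        ≤⟨ *-monoˡ-≤ a 6U+6≤a ⟩
    a * a                  ∎
    where
    open ≤-Reasoning
    e : ∀ U a → 6 * (U * a + a) ≡ (6 * U + 6) * a
    e = solve-∀

  6≤a : 6 ≤ a
  6≤a = ≤-trans (m≤n+m 6 (6 * U)) 6U+6≤a

  n≤a² : n ≤ a * a
  n≤a² = ≤-trans (m≤m+n n (5 * n)) 6n≤a²

  Ua≤n : U * a ≤ n
  Ua≤n = ≤-trans (m≤m+n (U * a) b) (≤-reflexive (sym n≡))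

  U²a²≤n² : U * U * (a * a) ≤ n * n
  U²a²≤n² = ≤-trans (≤-reflexive (e U a)) (*-mono-≤ Ua≤n Ua≤n)
    where
    e : ∀ U a → U * U * (a * a) ≡ U * a * (U * a)
    e = solve-∀

  n²≤ : n * n ≤ (U * U + 1) * (a * a)
  n²≤ = begin
    n * n                                                   ≡⟨ cong (λ x → x * x) n≡ ⟩
    (U * a + b) * (U * a + b)                               ≤⟨ *-mono-≤ (+-monoʳ-≤ (U * a) b≤U) (+-monoʳ-≤ (U * a) b≤U) ⟩
    (U * a + U) * (U * a + U)                               ≡⟨ e₁ U a ⟩
    U * U * (a * a) + (2 * (U * U) * a + U * U * 1)         ≤⟨ +-monoʳ-≤ (U * U * (a * a)) (+-monoʳ-≤ (2 * (U * U) * a) (*-monoʳ-≤ (U * U) 1≤a)) ⟩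
    U * U * (a * a) + (2 * (U * U) * a + U * U * a)         ≡⟨ cong (U * U * (a * a) +_) (*-distribʳ-+ a (2 * (U * U)) (U * U)) ⟨
    U * U * (a * a) + (2 * (U * U) + U * U) * a             ≤⟨ +-monoʳ-≤ (U * U * (a * a)) (*-monoˡ-≤ a (≤-trans (≤-trans (m≤m+n (2 * (U * U) + U * U) (3 * (U * U) + 6)) (≤-reflexive (e₂ (U * U)))) a-large)) ⟩
    U * U * (a * a) + a * a                                 ≡⟨ e₃ (U * U) (a * a) ⟩
    (U * U + 1) * (a * a)                                   ∎
    where
    open ≤-Reasoning
    e₁ : ∀ U a → (U * a + U) * (U * a + U) ≡ U * U * (a * a) + (2 * (U * U) * a + U * U * 1)
    e₁ = solve-∀
    e₂ : ∀ x → 2 * x + x + (3 * x + 6) ≡ 6 * x + 6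
    e₂ = solve-∀
    e₃ : ∀ x y → x * y + y ≡ (x + 1) * y
    e₃ = solve-∀

module LowerLadder (p a b U H : ℕ) (n≡ : suc p ≡ U * a + b) (b≤U : b ≤ U) (a-large : 6 * (U * U) + 6 ≤ a) where
  open Scale p a b U n≡ b≤U a-large
  open Complete p
  open Lower p

  relax : ∀ {v* v ρ ρ′} → Ascent v* v ρ → ρ ≤ ρ′ → Ascent v* v ρ′
  relax (end h)                     _ = end h
  relax (step κ ρ″ 1≤ drop large d) h = step κ ρ″ 1≤ (≤-trans drop h) large d

  sumTo-id≤ : ∀ v s → sumTo s id ≤ sumTo (v + s) (_∸ v)
  sumTo-id≤ v s = begin
    sumTo s id                                              ≡⟨ sumTo-cong s (λ i _ → m+n∸m≡n v i) ⟨
    sumTo s (λ i → (v + i) ∸ v)                             ≤⟨ m≤n+m _ _ ⟩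
    sumTo v (_∸ v) + sumTo s (λ i → (v + i) ∸ v)            ≡⟨ sumTo-append v s (_∸ v) ⟨
    sumTo (v + s) (_∸ v)                                    ∎
    where open ≤-Reasoning

  -- When κ - v is at most n - κ, truncation leaves the triangle 0 + ... + (s - 1) in both sums of
  -- `pool`.
  pool-short : ∀ {κ} v s τ → κ ≡ v + s → n ∸ κ ≡ τ + s → s * s ≤ pool κ v + s
  pool-short {κ} v s τ refl λ≡ = begin
    s * s                                   ≡⟨ 2*sumTo-id s ⟨
    2 * sumTo s id + s                      ≡⟨ cong (λ x → x + s) (cong (sumTo s id +_) (+-identityʳ _)) ⟩
    sumTo s id + sumTo s id + s             ≤⟨ +-monoˡ-≤ s (+-mono-≤ (sumTo-id≤ v s) second) ⟩
    pool κ v + s                            ∎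
    where
    open ≤-Reasoning
    e : ∀ v s τ → v + (τ + s) ≡ v + s + τ
    e = solve-∀
    second : sumTo s id ≤ sumTo (n ∸ κ) (λ j → (κ + j) ∸ (v + (n ∸ κ)))
    second = begin
      sumTo s id                                                      ≤⟨ sumTo-id≤ τ s ⟩
      sumTo (τ + s) (_∸ τ)                                            ≡⟨ sumTo-cong (τ + s) (λ j _ → [m+n]∸[m+o]≡n∸o κ j τ) ⟨
      sumTo (τ + s) (λ j → (κ + j) ∸ (κ + τ))                         ≡⟨ cong (λ x → sumTo (τ + s) (λ j → (κ + j) ∸ x)) (e v s τ) ⟨
      sumTo (τ + s) (λ j → (κ + j) ∸ (v + (τ + s)))                   ≡⟨ cong (λ x → sumTo x (λ j → (κ + j) ∸ (v + x))) λ≡ ⟨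
      sumTo (n ∸ κ) (λ j → (κ + j) ∸ (v + (n ∸ κ)))                   ∎

  -- When κ - v is at least n - κ, nothing is truncated in the second sum, which starts at d.
  pool-long : ∀ {κ} v λ′ d → κ ≡ v + (λ′ + d) → n ∸ κ ≡ λ′ →
              d * d + 4 * (λ′ * d) + 2 * (λ′ * λ′) ≤ 2 * pool κ v + (λ′ + d + λ′)
  pool-long {κ} v λ′ d refl λ≡ = begin
    d * d + 4 * (λ′ * d) + 2 * (λ′ * λ′)                                  ≡⟨ e₁ λ′ d ⟩
    (λ′ + d) * (λ′ + d) + 2 * (λ′ * d) + λ′ * λ′                          ≡⟨ cong₂ (λ x y → x + 2 * (λ′ * d) + y) (2*sumTo-id (λ′ + d)) (2*sumTo-id λ′) ⟨
    2 * sumTo (λ′ + d) id + (λ′ + d) + 2 * (λ′ * d) + (2 * sumTo λ′ id + λ′) ≡⟨ e₂ (sumTo (λ′ + d) id) (λ′ + d) (λ′ * d) (sumTo λ′ id) λ′ ⟩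
    2 * (sumTo (λ′ + d) id + (λ′ * d + sumTo λ′ id)) + (λ′ + d + λ′)      ≤⟨ +-monoˡ-≤ _ (*-monoʳ-≤ 2 (+-mono-≤ (sumTo-id≤ v (λ′ + d)) (≤-reflexive second))) ⟩
    2 * pool κ v + (λ′ + d + λ′)                                          ∎
    where
    open ≤-Reasoning
    e₁ : ∀ l d → d * d + 4 * (l * d) + 2 * (l * l) ≡ (l + d) * (l + d) + 2 * (l * d) + l * l
    e₁ = solve-∀
    e₂ : ∀ x s y z l → 2 * x + s + 2 * y + (2 * z + l) ≡ 2 * (x + (y + z)) + (s + l)
    e₂ = solve-∀
    e₃ : ∀ v l d j → v + (l + d) + j ≡ v + l + (d + j)
    e₃ = solve-∀
    second : λ′ * d + sumTo λ′ id ≡ sumTo (n ∸ κ) (λ j → (κ + j) ∸ (v + (n ∸ κ)))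
    second = subst (λ x → λ′ * d + sumTo λ′ id ≡ sumTo x (λ j → (κ + j) ∸ (v + x))) (sym λ≡) (trans (cong (_+ sumTo λ′ id) (sym (sumTo-const λ′ d))) (trans (sym (sumTo-+ λ′ (λ _ → d) id))
      (sumTo-cong λ′ λ j _ → trans (sym (m+n∸m≡n (v + λ′) (d + j))) (cong (_∸ (v + λ′)) (sym (e₃ v λ′ d j))))))

  -- A fixed κ serves L steps, each charged the price Δ of the lowest surplus; i steps are still to
  -- come and j are done.
  block : ∀ {v* V ρ′} κ v₀ Δ L → 1 ≤ ρ′ → κ ∸ v₀ + κ ≤ Δ →
          (∀ i j → suc i + j ≡ L → κ < n → ρ′ + i * Δ + (n + n) ≤ pool κ (v₀ + j)) →
          V ≡ v₀ + L → Ascent v* V ρ′ → ∀ i j → i + j ≡ L → Ascent v* (v₀ + j) (ρ′ + i * Δ)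
  block κ v₀ Δ L 1≤ Δ≥ large refl asc zero    j refl = subst (Ascent _ _) (sym (+-identityʳ _)) asc
  block {v*} {ρ′ = ρ′} κ v₀ Δ L 1≤ Δ≥ large e asc (suc i) j i+j≡L = step κ (ρ′ + i * Δ) (≤-trans 1≤ (m≤m+n ρ′ _))
    (≤-trans (+-monoʳ-≤ (ρ′ + i * Δ) (≤-trans (+-monoˡ-≤ κ (∸-monoʳ-≤ κ (≤-trans (m≤m+n v₀ j) (n≤1+n _)))) Δ≥))
      (≤-reflexive (trans (+-assoc ρ′ (i * Δ) Δ) (cong (ρ′ +_) (+-comm (i * Δ) Δ)))))
    (large i j i+j≡L)
    (subst (λ v → Ascent v* v (ρ′ + i * Δ)) (+-suc v₀ j) (block κ v₀ Δ L 1≤ Δ≥ large e asc i (suc j) (trans (+-suc i j) i+j≡L)))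

  -- One block of the ladder: κ = (U - l) a + b while the surplus grows from z a to (z + H) a.
  Regime : ℕ → ℕ → ℕ → Set
  Regime z P l = l ≡ 0
    ⊎ (∃ λ d → l + (l + d) + z ≡ U × H ≤ d × 2 * P + 1 ≤ d * d + 4 * (l * d) + 2 * (l * l))
    ⊎ (∃ λ e → l + e + z ≡ U × H ≤ e × e + 1 ≤ l × P + 1 ≤ e * e)

  -- With κ = (U - l) a + b a unit of surplus costs (2U - 2l - z) a + 2b; the extra H in `fall` pays
  -- for 2b ≤ a over H a units.
  rung : ∀ {v*} z P l P′ → l + z ≤ U → 1 ≤ P′ → P′ + H * (2 * U + 1) ≤ P + H * (2 * l + z) → Regime z P l →
         Ascent v* ((z + H) * a) (P′ * (a * a)) → Ascent v* (z * a) (P * (a * a))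
  rung {v*} z P l P′ l+z≤U 1≤P′ fall regime asc with m≤n⇒∃[o]m+o≡n l+z≤U
  ... | e , e≡ = relax (subst (λ v → Ascent v* v (P′ * (a * a) + H * a * Δ)) (+-identityʳ (z * a))
      (block κ (z * a) Δ (H * a) (*-mono-≤ 1≤P′ (*-mono-≤ 1≤a 1≤a)) ≤-refl large (*-distribʳ-+ a z H) asc (H * a) 0 (+-identityʳ _))) total
    where
    open ≤-Reasoning
    G κ Δ : ℕ
    G = e * a + b
    κ = z * a + G
    Δ = κ ∸ z * a + κ
    Δ≡ : Δ ≡ G + κ
    Δ≡ = cong (_+ κ) (m+n∸m≡n (z * a) G)
    n≡κ : n ≡ κ + l * a
    n≡κ = trans n≡ (trans (cong (λ x → x * a + b) (sym e≡)) (r l z e a b))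
      where
      r : ∀ l z e a b → (l + z + e) * a + b ≡ z * a + (e * a + b) + l * a
      r = solve-∀
    n∸κ : n ∸ κ ≡ l * a
    n∸κ = trans (cong (_∸ κ) n≡κ) (m+n∸m≡n κ (l * a))

    total : P′ * (a * a) + H * a * Δ ≤ P * (a * a)
    total = +-cancelʳ-≤ (H * (2 * l + z) * (a * a)) _ _ (begin
      P′ * (a * a) + H * a * Δ + H * (2 * l + z) * (a * a)                    ≡⟨ cong (λ x → P′ * (a * a) + H * a * x + H * (2 * l + z) * (a * a)) Δ≡ ⟩
      P′ * (a * a) + H * a * (G + κ) + H * (2 * l + z) * (a * a)              ≡⟨ e₁ P′ H a b e z l ⟩
      P′ * (a * a) + H * a * (2 * (l + z + e) * a + (b + b))                  ≤⟨ +-monoʳ-≤ (P′ * (a * a)) (*-monoʳ-≤ (H * a) (+-monoʳ-≤ (2 * (l + z + e) * a) b+b≤a)) ⟩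
      P′ * (a * a) + H * a * (2 * (l + z + e) * a + a)                        ≡⟨ cong (λ u → P′ * (a * a) + H * a * (2 * u * a + a)) e≡ ⟩
      P′ * (a * a) + H * a * (2 * U * a + a)                                  ≡⟨ e₂ P′ H a U ⟩
      (P′ + H * (2 * U + 1)) * (a * a)                                        ≤⟨ *-monoˡ-≤ (a * a) fall ⟩
      (P + H * (2 * l + z)) * (a * a)                                         ≡⟨ *-distribʳ-+ (a * a) P (H * (2 * l + z)) ⟩
      P * (a * a) + H * (2 * l + z) * (a * a)                                 ∎)
      where
      e₁ : ∀ P H a b e z l → P * (a * a) + H * a * (e * a + b + (z * a + (e * a + b))) + H * (2 * l + z) * (a * a)
           ≡ P * (a * a) + H * a * (2 * (l + z + e) * a + (b + b))
      e₁ = solve-∀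
      e₂ : ∀ P H a U → P * (a * a) + H * a * (2 * U * a + a) ≡ (P + H * (2 * U + 1)) * (a * a)
      e₂ = solve-∀

    -- To leading order the pool shrinks by at most 2G per unit of surplus, and at least that much
    -- deficit has been spent by then. So `Regime` need only hold at the start of a block.
    spent : ∀ i j → suc i + j ≡ H * a → P′ * (a * a) + i * Δ + j * (G + G) ≤ P * (a * a)
    spent i j s = begin
      P′ * (a * a) + i * Δ + j * (G + G)      ≤⟨ +-monoʳ-≤ (P′ * (a * a) + i * Δ) (*-monoʳ-≤ j (≤-trans (+-monoʳ-≤ G (m≤n+m G (z * a))) (≤-reflexive (sym Δ≡)))) ⟩
      P′ * (a * a) + i * Δ + j * Δ            ≡⟨ trans (+-assoc (P′ * (a * a)) (i * Δ) (j * Δ)) (cong (P′ * (a * a) +_) (sym (*-distribʳ-+ Δ i j))) ⟩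
      P′ * (a * a) + (i + j) * Δ              ≤⟨ +-monoʳ-≤ (P′ * (a * a)) (*-monoˡ-≤ Δ (≤-trans (n≤1+n (i + j)) (≤-reflexive s))) ⟩
      P′ * (a * a) + H * a * Δ                ≤⟨ total ⟩
      P * (a * a)                             ∎

    large : ∀ i j → suc i + j ≡ H * a → κ < n → P′ * (a * a) + i * Δ + (n + n) ≤ pool κ (z * a + j)
    large i j s κ<n = by regime
      where
      X : ℕ
      X = P′ * (a * a) + i * Δ
      j≤ : ∀ {x} → H ≤ x → j ≤ x * a
      j≤ H≤x = ≤-trans (≤-trans (m≤n+m j (suc i)) (≤-reflexive s)) (*-monoˡ-≤ a H≤x)
      by : Regime z P l → X + (n + n) ≤ pool κ (z * a + j)
      by (inj₁ refl) = ⊥-elim (<⇒≢ κ<n (sym (trans n≡κ (+-identityʳ κ))))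
      by (inj₂ (inj₁ (d₀ , d₀≡ , H≤d₀ , area))) with m≤n⇒∃[o]m+o≡n (≤-trans (j≤ H≤d₀) (m≤m+n (d₀ * a) b))
      ... | d , j+d≡ = *-cancelˡ-≤ 2 (+-cancelʳ-≤ (l * a + d + l * a) _ _ (begin
        2 * (X + (n + n)) + (l * a + d + l * a)                  ≤⟨ +-monoʳ-≤ (2 * (X + (n + n))) (+-mono-≤ la+d≤n la≤n) ⟩
        2 * (X + (n + n)) + (n + n)                              ≡⟨ e₁ X n ⟩
        2 * X + 6 * n                                            ≤⟨ +-monoʳ-≤ (2 * X) 6n≤a² ⟩
        2 * X + a * a                                            ≤⟨ +-cancelʳ-≤ (j * (d + d) + 4 * (l * a * j) + j * j) _ _ squares ⟩
        d * d + 4 * (l * a * d) + 2 * (l * a * (l * a))          ≤⟨ pool-long (z * a + j) (l * a) d κ-split n∸κ ⟩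
        2 * pool κ (z * a + j) + (l * a + d + l * a)             ∎))
        where
        e≡l+d₀ : e ≡ l + d₀
        e≡l+d₀ = +-cancelˡ-≡ (l + z) _ _ (trans e≡ (trans (sym d₀≡) (r l d₀ z)))
          where
          r : ∀ l d z → l + (l + d) + z ≡ l + z + (l + d)
          r = solve-∀
        G≡ : G ≡ l * a + (j + d)
        G≡ = trans (cong (λ x → x * a + b) e≡l+d₀) (trans (r l d₀ a b) (cong (l * a +_) (sym j+d≡)))
          where
          r : ∀ l d a b → (l + d) * a + b ≡ l * a + (d * a + b)
          r = solve-∀
        κ-split : κ ≡ z * a + j + (l * a + d)
        κ-split = trans (cong (z * a +_) G≡) (r (z * a) (l * a) j d)
          where
          r : ∀ x y j d → x + (y + (j + d)) ≡ x + j + (y + d)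
          r = solve-∀
        la+d≤n : l * a + d ≤ n
        la+d≤n = ≤-trans (m≤n+m (l * a + d) (z * a + j)) (≤-trans (≤-reflexive (sym κ-split)) (<⇒≤ κ<n))
        la≤n : l * a ≤ n
        la≤n = ≤-trans (m≤m+n (l * a) d) la+d≤n
        e₁ : ∀ X n → 2 * (X + (n + n)) + (n + n) ≡ 2 * X + 6 * n
        e₁ = solve-∀
        squares : 2 * X + a * a + (j * (d + d) + 4 * (l * a * j) + j * j) ≤
                  d * d + 4 * (l * a * d) + 2 * (l * a * (l * a)) + (j * (d + d) + 4 * (l * a * j) + j * j)
        squares = begin
          2 * X + a * a + (j * (d + d) + 4 * (l * a * j) + j * j)               ≤⟨ m≤m+n _ (j * (d + d) + 3 * (j * j)) ⟩
          2 * X + a * a + (j * (d + d) + 4 * (l * a * j) + j * j) + (j * (d + d) + 3 * (j * j)) ≡⟨ e₂ X a j d (l * a) ⟩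
          2 * (X + j * (l * a + (j + d) + (l * a + (j + d)))) + a * a           ≡⟨ cong (λ g → 2 * (X + j * (g + g)) + a * a) G≡ ⟨
          2 * (X + j * (G + G)) + a * a                                         ≤⟨ +-monoˡ-≤ (a * a) (*-monoʳ-≤ 2 (spent i j s)) ⟩
          2 * (P * (a * a)) + a * a                                             ≡⟨ e₃ P a ⟩
          (2 * P + 1) * (a * a)                                                 ≤⟨ *-monoˡ-≤ (a * a) area ⟩
          (d₀ * d₀ + 4 * (l * d₀) + 2 * (l * l)) * (a * a)                      ≡⟨ e₄ d₀ l a ⟩
          d₀ * a * (d₀ * a) + 4 * (l * a * (d₀ * a)) + 2 * (l * a * (l * a))    ≤⟨ +-monoˡ-≤ _ (+-mono-≤ (*-mono-≤ d₀a≤ d₀a≤) (*-monoʳ-≤ 4 (*-monoʳ-≤ (l * a) d₀a≤))) ⟩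
          (j + d) * (j + d) + 4 * (l * a * (j + d)) + 2 * (l * a * (l * a))     ≡⟨ e₅ j d (l * a) ⟩
          d * d + 4 * (l * a * d) + 2 * (l * a * (l * a)) + (j * (d + d) + 4 * (l * a * j) + j * j) ∎
          where
          d₀a≤ : d₀ * a ≤ j + d
          d₀a≤ = ≤-trans (m≤m+n (d₀ * a) b) (≤-reflexive (sym j+d≡))
          e₂ : ∀ X a j d y → 2 * X + a * a + (j * (d + d) + 4 * (y * j) + j * j) + (j * (d + d) + 3 * (j * j))
               ≡ 2 * (X + j * (y + (j + d) + (y + (j + d)))) + a * a
          e₂ = solve-∀
          e₃ : ∀ P a → 2 * (P * (a * a)) + a * a ≡ (2 * P + 1) * (a * a)
          e₃ = solve-∀
          e₄ : ∀ d l a → (d * d + 4 * (l * d) + 2 * (l * l)) * (a * a) ≡ d * a * (d * a) + 4 * (l * a * (d * a)) + 2 * (l * a * (l * a))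
          e₄ = solve-∀
          e₅ : ∀ j d y → (j + d) * (j + d) + 4 * (y * (j + d)) + 2 * (y * y) ≡ d * d + 4 * (y * d) + 2 * (y * y) + (j * (d + d) + 4 * (y * j) + j * j)
          e₅ = solve-∀
      by (inj₂ (inj₂ (e′ , e′≡ , H≤e′ , e′<l , area))) with +-cancelˡ-≡ (l + z) _ _ (trans e≡ (trans (sym e′≡) (swap l e′ z)))
        where
        swap : ∀ l e z → l + e + z ≡ l + z + e
        swap = solve-∀
      ... | refl with m≤n⇒∃[o]m+o≡n (≤-trans (j≤ H≤e′) (m≤m+n (e * a) b))
      ...   | s′ , j+s≡ with m≤n⇒∃[o]m+o≡n s≤la
        where
        s≤la : s′ ≤ l * a
        s≤la = begin
          s′               ≤⟨ m≤n+m s′ j ⟩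
          j + s′           ≡⟨ j+s≡ ⟩
          e * a + b        ≤⟨ +-monoʳ-≤ (e * a) b≤a ⟩
          e * a + a        ≡⟨ trans (cong (e * a +_) (sym (*-identityˡ a))) (sym (*-distribʳ-+ a e 1)) ⟩
          (e + 1) * a      ≤⟨ *-monoˡ-≤ a e′<l ⟩
          l * a            ∎
      ...     | τ , s+τ≡ = +-cancelʳ-≤ s′ _ _ (begin
        X + (n + n) + s′                   ≤⟨ +-monoʳ-≤ (X + (n + n)) s′≤n ⟩
        X + (n + n) + n                    ≤⟨ m≤m+n _ (3 * n) ⟩
        X + (n + n) + n + 3 * n            ≡⟨ e₁ X n ⟩
        X + 6 * n                          ≤⟨ +-monoʳ-≤ X 6n≤a² ⟩
        X + a * a                          ≤⟨ +-cancelʳ-≤ (2 * (j * s′) + j * j) _ _ squares ⟩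
        s′ * s′                            ≤⟨ pool-short (z * a + j) s′ τ κ-split (trans n∸κ (trans (sym s+τ≡) (+-comm s′ τ))) ⟩
        pool κ (z * a + j) + s′            ∎)
        where
        κ-split : κ ≡ z * a + j + s′
        κ-split = trans (cong (z * a +_) (sym j+s≡)) (sym (+-assoc (z * a) j s′))
        s′≤n : s′ ≤ n
        s′≤n = ≤-trans (m≤n+m s′ (z * a + j)) (≤-trans (≤-reflexive (sym κ-split)) (<⇒≤ κ<n))
        e₁ : ∀ X n → X + (n + n) + n + 3 * n ≡ X + 6 * n
        e₁ = solve-∀
        squares : X + a * a + (2 * (j * s′) + j * j) ≤ s′ * s′ + (2 * (j * s′) + j * j)
        squares = begin
          X + a * a + (2 * (j * s′) + j * j)              ≤⟨ m≤m+n _ (j * j) ⟩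
          X + a * a + (2 * (j * s′) + j * j) + j * j      ≡⟨ e₂ X a j s′ ⟩
          X + j * (j + s′ + (j + s′)) + a * a             ≡⟨ cong (λ g → X + j * (g + g) + a * a) j+s≡ ⟩
          X + j * (G + G) + a * a                         ≤⟨ +-monoˡ-≤ (a * a) (spent i j s) ⟩
          P * (a * a) + a * a                             ≡⟨ e₃ P a ⟩
          (P + 1) * (a * a)                               ≤⟨ *-monoˡ-≤ (a * a) area ⟩
          e * e * (a * a)                                 ≡⟨ e₄ e a ⟩
          e * a * (e * a)                                 ≤⟨ *-mono-≤ ea≤ ea≤ ⟩
          (j + s′) * (j + s′)                             ≡⟨ e₅ j s′ ⟩
          s′ * s′ + (2 * (j * s′) + j * j)                ∎
          where
          ea≤ : e * a ≤ j + s′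
          ea≤ = ≤-trans (m≤m+n (e * a) b) (≤-reflexive (sym j+s≡))
          e₂ : ∀ X a j s → X + a * a + (2 * (j * s) + j * j) + j * j ≡ X + j * (j + s + (j + s)) + a * a
          e₂ = solve-∀
          e₃ : ∀ P a → P * (a * a) + a * a ≡ (P + 1) * (a * a)
          e₃ = solve-∀
          e₄ : ∀ e a → e * e * (a * a) ≡ e * a * (e * a)
          e₄ = solve-∀
          e₅ : ∀ j s → (j + s) * (j + s) ≡ s * s + (2 * (j * s) + j * j)
          e₅ = solve-∀

-- The two recursions as Boolean tests on numbers.

∧-split : ∀ {x y} → T (x ∧ y) → T x × T y
∧-split = Equivalence.to T-∧

∨-split : ∀ {x y} → T (x ∨ y) → T x ⊎ T y
∨-split = Equivalence.to T-∨

if-split : ∀ {x y} → T (if x then y else false) → T x × T y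
if-split {true} h = _ , h

-- One Newton step from x towards the square root of y; the `+ 2` outweighs the roundings, so the
-- result is never below the root.
newton : ℕ → ℕ → ℕ
newton x y = (x + y / suc x) / 2 + 2

module Climb (U H Z : ℕ) where

  -- With w = U - z = 2l + d the area d² + 4ld + 2l² equals w² - 2l², which eliminates d; in the
  -- short regime e = w - l.
  long? short? regime? : ℕ → ℕ → ℕ → Bool
  long?  w P l = (l + l + H ≤ᵇ w) ∧ (2 * P + 1 + 2 * (l * l) ≤ᵇ w * w)
  short? w P l = (l + H ≤ᵇ w) ∧ (w + 1 ≤ᵇ l + l) ∧ (P + 1 ≤ᵇ (w ∸ l) * (w ∸ l))
  regime? w P l = (l ≡ᵇ 0) ∨ long? w P l ∨ short? w P l

  -- The guesses need no verification: climb checks what they are used for.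
  longGuess : ℕ → ℕ → ℕ → ℕ
  longGuess w l X = (X / suc (newton l X)) ⊓′ ((w ∸ H) / 2)

  shortGuess : ℕ → ℕ → ℕ
  shortGuess w l = if w <ᵇ l + l then l else (w ∸ H) / 2

  -- A large l means a small κ and a low price. The regimes allow l up to about √((w² - 2P - 1)/2)
  -- and w - √(P + 1); the previous l seeds the Newton step, and (w - H)/2 is the end of the long
  -- regime, used in the gap between the two.
  guess : ℕ → ℕ → ℕ → ℕ
  guess w P l = if l + l + H ≤ᵇ w
    then longGuess w l ((w * w ∸ (2 * P + 1)) / 2)
    else shortGuess w (w ∸ newton (w ∸ l) (P + 1))

  mutual
    climb : ℕ → ℕ → ℕ → ℕ → Bool
    climb zero    z P l = Z ≤ᵇ z
    climb (suc k) z P l = climbWith k z P (guess (U ∸ z) P l)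

    climbWith : ℕ → ℕ → ℕ → ℕ → Bool
    climbWith k z P l = if (l + z ≤ᵇ U) ∧ regime? (U ∸ z) P l
      then climbTo k z l (P + H * (2 * l + z) ∸ H * (2 * U + 1)) else false

    climbTo : ℕ → ℕ → ℕ → ℕ → Bool
    climbTo k z l P′ = if 1 ≤ᵇ P′ then climb k (z + H) P′ l else false

module Climbing (p a b U H Z : ℕ) (n≡ : suc p ≡ U * a + b) (b≤U : b ≤ U) (a-large : 6 * (U * U) + 6 ≤ a) where
  open Lower p
  open LowerLadder p a b U H n≡ b≤U a-large
  open Climb U H Z

  regime-sound : ∀ z P l → l + z ≤ U → T (regime? (U ∸ z) P l) → Regime z P l
  regime-sound z P l l+z≤U t with ∨-split {l ≡ᵇ 0} t
  ... | inj₁ l≡0 = inj₁ (≡ᵇ⇒≡ l 0 l≡0)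
  ... | inj₂ t′ with ∨-split {long? (U ∸ z) P l} t′
  ...   | inj₁ t″ with ∧-split {l + l + H ≤ᵇ U ∸ z} t″
  ...     | t₁ , t₂ with m≤n⇒∃[o]m+o≡n (≤ᵇ⇒≤ (l + l + H) (U ∸ z) t₁)
  ...       | o , e = inj₂ (inj₁ (H + o , sum , m≤m+n H o , +-cancelʳ-≤ (2 * (l * l)) _ _ (begin
    2 * P + 1 + 2 * (l * l)                                                ≤⟨ ≤ᵇ⇒≤ _ _ t₂ ⟩
    (U ∸ z) * (U ∸ z)                                                      ≡⟨ cong (λ w → w * w) e ⟨
    (l + l + H + o) * (l + l + H + o)                                      ≡⟨ square l H o ⟩
    (H + o) * (H + o) + 4 * (l * (H + o)) + 2 * (l * l) + 2 * (l * l)      ∎)))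
    where
    open ≤-Reasoning
    square : ∀ l H o → (l + l + H + o) * (l + l + H + o) ≡ (H + o) * (H + o) + 4 * (l * (H + o)) + 2 * (l * l) + 2 * (l * l)
    square = solve-∀
    sum : l + (l + (H + o)) + z ≡ U
    sum = trans (cong (_+ z) (trans (regroup l H o) e)) (m∸n+n≡m (≤-trans (m≤n+m z l) l+z≤U))
      where
      regroup : ∀ l H o → l + (l + (H + o)) ≡ l + l + H + o
      regroup = solve-∀
  regime-sound z P l l+z≤U t | inj₂ t′ | inj₂ t″ with ∧-split {l + H ≤ᵇ U ∸ z} t″
  ... | t₁ , t₂ with ∧-split {(U ∸ z) + 1 ≤ᵇ l + l} t₂ | m≤n⇒∃[o]m+o≡n (≤ᵇ⇒≤ (l + H) (U ∸ z) t₁)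
  ...   | t₃ , t₄ | o , e = inj₂ (inj₂ (H + o , sum , m≤m+n H o ,
    +-cancelˡ-≤ l _ _ (subst (_≤ l + l) (trans (cong (_+ 1) (sym w≡)) (+-assoc l (H + o) 1)) (≤ᵇ⇒≤ _ _ t₃)) ,
    subst (λ g → P + 1 ≤ g * g) (trans (cong (_∸ l) (sym w≡)) (m+n∸m≡n l (H + o))) (≤ᵇ⇒≤ _ _ t₄)))
    where
    w≡ : l + (H + o) ≡ U ∸ z
    w≡ = trans (sym (+-assoc l H o)) e
    sum : l + (H + o) + z ≡ U
    sum = trans (cong (_+ z) w≡) (m∸n+n≡m (≤-trans (m≤n+m z l) l+z≤U))

  ascent : ∀ k z P l → T (climb k z P l) → Ascent (Z * a) (z * a) (P * (a * a))
  ascent zero    z P l t = end (*-monoˡ-≤ a (≤ᵇ⇒≤ Z z t))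
  ascent (suc k) z P l t = next (guess (U ∸ z) P l) t
    where
    next : ∀ l → T (climbWith k z P l) → Ascent (Z * a) (z * a) (P * (a * a))
    next l t with if-split {(l + z ≤ᵇ U) ∧ regime? (U ∸ z) P l} t
    ... | ok , t′ with ∧-split {l + z ≤ᵇ U} ok | if-split {1 ≤ᵇ P + H * (2 * l + z) ∸ H * (2 * U + 1)} t′
    ...   | t₁ , t₂ | t₃ , rest = rung z P l P′ (≤ᵇ⇒≤ _ _ t₁) 1≤P′
      (≤-reflexive (exact (P + H * (2 * l + z)) (H * (2 * U + 1)) 1≤P′))
      (regime-sound z P l (≤ᵇ⇒≤ _ _ t₁) t₂) (ascent k (z + H) P′ l rest)
      where
      P′ : ℕ
      P′ = P + H * (2 * l + z) ∸ H * (2 * U + 1)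
      1≤P′ : 1 ≤ P′
      1≤P′ = ≤ᵇ⇒≤ 1 P′ t₃
      -- The test `1 ≤ P′` certifies at the same time that the truncated subtraction defining P′ is
      -- exact.
      exact : ∀ x y → 1 ≤ x ∸ y → x ∸ y + y ≡ x
      exact x y pos = m∸n+n≡m y≤x
        where
        y≤x : y ≤ x
        y≤x = ≮⇒≥ λ x<y → <⇒≱ pos (≤-reflexive (m≤n⇒m∸n≡0 (<⇒≤ x<y)))

module Descend (U L C : ℕ) where

  -- Since dD = q dq / (2q - U), a geometric decrease of 2q - U spends comparable amounts of D,
  -- about q / (2L + 2), in every step.
  lowered : ℕ → ℕ
  lowered q = q ∸ (2 * q ∸ U) / suc L / 2 ∸ 1

  mutual
    descend : ℕ → ℕ → ℕ → Bool
    descend zero    q left = (U + 1 ≤ᵇ q + q) ∧ (q ≤ᵇ U) ∧ (U * U + q * q + 4 ≤ᵇ 2 * C)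
    descend (suc k) q left = descendTo k q left (lowered q)

    descendTo : ℕ → ℕ → ℕ → ℕ → Bool
    -- d units of D must save q² - q′² at the rate 2(2q′ - U - 1); `suc` avoids a zero divisor, and
    -- `descendBy` tests whether the rounded d suffices.
    descendTo k q left q′ = descendBy k q left q′ ((q * q ∸ q′ * q′) / suc (2 * (q′ + q′ ∸ (U + 1))) + 2)

    descendBy : ℕ → ℕ → ℕ → ℕ → ℕ → Bool
    descendBy k q left q′ d =
      if (U + 1 ≤ᵇ q′ + q′) ∧ (q′ ≤ᵇ U) ∧ (q * q ≤ᵇ q′ * q′ + 2 * (d * (q′ + q′ ∸ (U + 1)))) ∧ (d ≤ᵇ left)
      then descend k q′ (left ∸ d) else false

module Descending (p a b U L C : ℕ) (n≡ : suc p ≡ U * a + b) (b≤U : b ≤ U) (a-large : 6 * (U * U) + 6 ≤ a) where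
  open Complete p using (n)
  open Upper p using (Descent; end; step)
  open Descend U L C
  open Scale p a b U n≡ b≤U a-large

  Θ : ℕ
  Θ = C * (a * a)

  relax : ∀ {D M M′} → Descent Θ D M → M′ ≤ M → Descent Θ D M′
  relax (end h)                         le = end (≤-trans (+-monoˡ-≤ 4 le) h)
  relax (step Q M″ 3≤Q Q≤n drop base d) le =
    step Q M″ 3≤Q Q≤n (≤-trans (+-monoˡ-≤ 4 (+-monoˡ-≤ (2 * n) le)) drop) base d

  -- The doubled isoperimetric bound for q a edges; the summand 2 covers the lower-order terms of n²
  -- + n + 4.
  μ : ℕ → ℕ
  μ q = (U * U + q * q + 2) * (a * a)

  n²+n+4≤ : n * n + n + 4 ≤ (U * U + 2) * (a * a)
  n²+n+4≤ = begin
    n * n + n + 4                                                 ≡⟨ cong (λ x → x * x + x + 4) n≡ ⟩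
    (U * a + b) * (U * a + b) + (U * a + b) + 4                   ≤⟨ +-monoˡ-≤ 4 (+-mono-≤ (*-mono-≤ Ua+b≤ Ua+b≤) Ua+b≤) ⟩
    (U * a + U) * (U * a + U) + (U * a + U) + 4                   ≡⟨ e₁ U a ⟩
    U * U * (a * a) + (2 * (U * U) * a + U * a + (U * U + U + 4)) ≤⟨ +-monoʳ-≤ (U * U * (a * a)) (+-mono-≤ first second) ⟩
    U * U * (a * a) + (a * a + a * a)                             ≡⟨ e₂ U a ⟩
    (U * U + 2) * (a * a)                                         ∎
    where
    open ≤-Reasoning
    Ua+b≤ : U * a + b ≤ U * a + U
    Ua+b≤ = +-monoʳ-≤ (U * a) b≤U
    e₁ : ∀ U a → (U * a + U) * (U * a + U) + (U * a + U) + 4 ≡ U * U * (a * a) + (2 * (U * U) * a + U * a + (U * U + U + 4))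
    e₁ = solve-∀
    e₂ : ∀ U a → U * U * (a * a) + (a * a + a * a) ≡ (U * U + 2) * (a * a)
    e₂ = solve-∀
    e₃ : ∀ x → 2 * x + x + (3 * x + 6) ≡ 6 * x + 6
    e₃ = solve-∀
    e₄ : ∀ x → x + x + 4 + (4 * x + 2) ≡ 6 * x + 6
    e₄ = solve-∀
    first : 2 * (U * U) * a + U * a ≤ a * a
    first = ≤-trans (≤-reflexive (sym (*-distribʳ-+ a (2 * (U * U)) U))) (*-monoˡ-≤ a
      (≤-trans (+-monoʳ-≤ (2 * (U * U)) U≤U²) (≤-trans (≤-trans (m≤m+n _ (3 * (U * U) + 6)) (≤-reflexive (e₃ (U * U)))) a-large)))
    second : U * U + U + 4 ≤ a * a
    second = ≤-trans (+-monoˡ-≤ 4 (+-monoʳ-≤ (U * U) U≤U²)) (≤-trans (≤-trans (m≤m+n _ (4 * (U * U) + 2)) (≤-reflexive (e₄ (U * U))))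
      (≤-trans a-large (≤-trans (≤-reflexive (sym (*-identityʳ a))) (*-monoʳ-≤ a 1≤a))))

  -- With Q = q a fixed, each unit of D brings M down by (4q - 2U) a up to rounding, and `base`
  -- stays true because M is only larger at larger D.
  stretch : ∀ {D M} q → U + 1 ≤ q + q → q ≤ U → μ q ≤ M → Descent Θ D M →
            ∀ i → Descent Θ (i + D) (M + i * (2 * (q + q ∸ (U + 1)) * a))
  stretch q 2q> q≤U base d zero    = relax d (≤-reflexive (+-identityʳ _))
  stretch {D} {M} q 2q> q≤U base d (suc i) with m≤n⇒∃[o]m+o≡n 2q> | stretch q 2q> q≤U base d i
  ... | W , e | rest = step (q * a) (M + i * δ) (*-mono-≤ {1} {q} {3} {a} 1≤q (≤-trans (s≤s (s≤s (s≤s z≤n))) 6≤a))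
      (≤-trans (*-monoˡ-≤ a q≤U) (≤-trans (m≤m+n (U * a) b) (≤-reflexive (sym n≡)))) drop′ base′ rest
    where
    open ≤-Reasoning
    δ : ℕ
    δ = 2 * (q + q ∸ (U + 1)) * a
    δ≡ : δ ≡ 2 * W * a
    δ≡ = cong (λ x → 2 * x * a) (trans (cong (_∸ (U + 1)) (sym e)) (m+n∸m≡n (U + 1) W))
    1≤q : 1 ≤ q
    1≤q = ≰⇒> λ q≤0 → <⇒≱ (≤-trans (m≤n+m 1 U) 2q>) (+-mono-≤ q≤0 q≤0)
    drop′ : M + suc i * δ + 2 * n + 4 ≤ M + i * δ + 4 * (q * a)
    drop′ = begin
      M + suc i * δ + 2 * n + 4                                ≡⟨ cong₂ (λ x y → M + (x + i * δ) + 2 * y + 4) δ≡ n≡ ⟩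
      M + (2 * W * a + i * δ) + 2 * (U * a + b) + 4            ≡⟨ e₁ M (2 * W * a) (i * δ) (U * a) b ⟩
      M + i * δ + (2 * W * a + 2 * (U * a) + (b + b + 4))      ≤⟨ +-monoʳ-≤ (M + i * δ) (+-monoʳ-≤ (2 * W * a + 2 * (U * a)) (+-mono-≤ b+b≤a (≤-trans (m≤m+n 4 2) 6≤a))) ⟩
      M + i * δ + (2 * W * a + 2 * (U * a) + (a + a))          ≡⟨ cong (M + i * δ +_) (e₂ W U a) ⟩
      M + i * δ + 2 * ((U + 1 + W) * a)                        ≡⟨ cong (λ x → M + i * δ + 2 * (x * a)) e ⟩
      M + i * δ + 2 * ((q + q) * a)                            ≡⟨ cong (M + i * δ +_) (e₃ q a) ⟩
      M + i * δ + 4 * (q * a)                                  ∎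
      where
      e₁ : ∀ M x y u b → M + (x + y) + 2 * (u + b) + 4 ≡ M + y + (x + 2 * u + (b + b + 4))
      e₁ = solve-∀
      e₂ : ∀ W U a → 2 * W * a + 2 * (U * a) + (a + a) ≡ 2 * ((U + 1 + W) * a)
      e₂ = solve-∀
      e₃ : ∀ q a → 2 * ((q + q) * a) ≡ 4 * (q * a)
      e₃ = solve-∀
    base′ : n * n + q * a * (q * a) + n + 4 ≤ M + i * δ + 3 * (q * a)
    base′ = begin
      n * n + q * a * (q * a) + n + 4              ≡⟨ e₁ (n * n) (q * a * (q * a)) n ⟩
      n * n + n + 4 + q * a * (q * a)              ≤⟨ +-monoˡ-≤ _ n²+n+4≤ ⟩
      (U * U + 2) * (a * a) + q * a * (q * a)      ≡⟨ e₂ (U * U) q a ⟩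
      μ q                                          ≤⟨ base ⟩
      M                                            ≤⟨ ≤-trans (m≤m+n M (i * δ)) (m≤m+n _ _) ⟩
      M + i * δ + 3 * (q * a)                      ∎
      where
      e₁ : ∀ x y n → x + y + n + 4 ≡ x + n + 4 + y
      e₁ = solve-∀
      e₂ : ∀ u q a → (u + 2) * (a * a) + q * a * (q * a) ≡ (u + q * q + 2) * (a * a)
      e₂ = solve-∀

  -- The bound falls from `μ q` to `μ q′` while D drops by d a. After the last test the rest of D is
  -- passed with q unchanged, where the bound does not rise because 2q > U.
  descent : ∀ k q left → T (descend k q left) → ∀ D M → left * a ≤ D → M ≤ μ q → Descent Θ D M
  descent zero q left t D M _ M≤ with ∧-split {U + 1 ≤ᵇ q + q} t
  ... | t₁ , t₂ with ∧-split {q ≤ᵇ U} t₂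
  ...   | t₃ , t₄ = subst (λ D → Descent Θ D M) (+-identityʳ D)
    (relax (stretch q (≤ᵇ⇒≤ _ _ t₁) (≤ᵇ⇒≤ q U t₃) ≤-refl (end finish) D) (≤-trans M≤ (m≤m+n (μ q) _)))
    where
    open ≤-Reasoning
    finish : μ q + 4 ≤ 2 * Θ
    finish = begin
      μ q + 4                               ≤⟨ +-monoʳ-≤ (μ q) (*-mono-≤ {2} {2} ≤-refl (*-mono-≤ (≤-trans (m≤m+n 2 4) 6≤a) 1≤a)) ⟩
      μ q + 2 * (a * a)                     ≡⟨ e (U * U + q * q) (a * a) ⟩
      (U * U + q * q + 4) * (a * a)         ≤⟨ *-monoˡ-≤ (a * a) (≤ᵇ⇒≤ (U * U + q * q + 4) (2 * C) t₄) ⟩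
      2 * C * (a * a)                       ≡⟨ *-assoc 2 C (a * a) ⟩
      2 * Θ                                 ∎
      where
      e : ∀ x y → (x + 2) * y + 2 * y ≡ (x + 4) * y
      e = solve-∀
  descent (suc k) q left t D M left≤ M≤ =
    by (lowered q) ((q * q ∸ lowered q * lowered q) / suc (2 * (lowered q + lowered q ∸ (U + 1))) + 2) t
    where
    open ≤-Reasoning
    by : ∀ q′ d → T (descendBy k q left q′ d) → Descent Θ D M
    by q′ d t with if-split {(U + 1 ≤ᵇ q′ + q′) ∧ (q′ ≤ᵇ U) ∧ (q * q ≤ᵇ q′ * q′ + 2 * (d * (q′ + q′ ∸ (U + 1)))) ∧ (d ≤ᵇ left)} t
    ... | ok , rest with ∧-split {U + 1 ≤ᵇ q′ + q′} ok
    ... | t₁ , ok₁ with ∧-split {q′ ≤ᵇ U} ok₁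
    ... | t₂ , ok₂ with ∧-split {q * q ≤ᵇ q′ * q′ + 2 * (d * (q′ + q′ ∸ (U + 1)))} ok₂
    ... | t₃ , t₄ = subst (λ D → Descent Θ D M) (m+[n∸m]≡n da≤D)
      (relax (stretch q′ (≤ᵇ⇒≤ _ _ t₁) (≤ᵇ⇒≤ q′ U t₂) ≤-refl
        (descent k q′ (left ∸ d) rest (D ∸ d * a) (μ q′) remaining ≤-refl) (d * a)) (≤-trans M≤ fall))
      where
      d≤left : d ≤ left
      d≤left = ≤ᵇ⇒≤ d left t₄
      da≤D : d * a ≤ D
      da≤D = ≤-trans (*-monoˡ-≤ a d≤left) left≤
      remaining : (left ∸ d) * a ≤ D ∸ d * a
      remaining = ≤-trans (≤-reflexive (*-distribʳ-∸ a left d)) (∸-monoˡ-≤ (d * a) left≤)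
      W : ℕ
      W = q′ + q′ ∸ (U + 1)
      fall : μ q ≤ μ q′ + d * a * (2 * W * a)
      fall = begin
        (U * U + q * q + 2) * (a * a)                           ≤⟨ *-monoˡ-≤ (a * a) (+-monoˡ-≤ 2 (+-monoʳ-≤ (U * U) (≤ᵇ⇒≤ _ _ t₃))) ⟩
        (U * U + (q′ * q′ + 2 * (d * W)) + 2) * (a * a)         ≡⟨ e (U * U) (q′ * q′) d W a ⟩
        μ q′ + d * a * (2 * W * a)                              ∎
        where
        e : ∀ u x d W a → (u + (x + 2 * (d * W)) + 2) * (a * a) ≡ (u + x + 2) * (a * a) + d * a * (2 * W * a)
        e = solve-∀

-- In units of n / U, Max reaches surplus Z in steps of H, starting from deficit P (in square
-- units), and Min multiplies 2 q - U by 1 - 1 / (L + 1) per step.  C′ and C are the resulting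
-- bounds on the game length in square units.
module Bounds (U H Z L C C′ P x₁ x₂ y k₁ k₂ : ℕ)
  (climbs : T (Climb.climb U H Z k₁ 0 P 0)) (descends : T (Descend.descend U L C k₂ U (U ∸ 1)))
  (Z≤U : Z ≤ U) (P-small : 2 * P + 1 ≤ U * U) (C′-small : 2 * C′ + 1 ≤ U * U + Z * Z)
  (C′-large : x₁ * (U * U + 1) < y * C′) (C-small : y * C < x₂ * (U * U)) where

  Bounded : ℕ → Set
  Bounded m = (∃ λ t → Toppling.IsTopplingNumber (K m) t) ×
    (∀ t → Toppling.IsTopplingNumber (K m) t → (x₁ * (m * m) < y * t) × (y * t < x₂ * (m * m)))

  bounded : ∀ p a b → suc p ≡ U * a + b → b ≤ U → 1 ≤ U → 6 * (U * U) + 6 ≤ a → Bounded (suc p)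
  bounded p a b n≡ b≤U 1≤U a-large = value-exists (n * (n + n)) Max empty empty (same λ _ → refl)
      (λ v → subst (0 <_) (sym (deg≡p v)) 0<p) (m≤n+m _ (S empty)) ,
    λ t val → above t (lower-bound (ascent k₁ 0 P 0 climbs) ρ-small val) ,
              below t (upper-bound 0<p (descent k₂ U (U ∸ 1) descends p (μ U) left≤p ≤-refl) 2np≤ val)
    where
    open Complete p
    open Upper.Play p (C * (a * a)) using (upper-bound)
    open Descending p a b U L C n≡ b≤U a-large using (descent; μ)
    open Climbing p a b U H Z n≡ b≤U a-large using (ascent)
    open Scale p a b U n≡ b≤U a-large
    open ≤-Reasoning

    a≤n : a ≤ n
    a≤n = ≤-trans (≤-trans (≤-reflexive (sym (*-identityˡ a))) (*-monoˡ-≤ a 1≤U)) Ua≤n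

    0<p : 0 < p
    0<p = s≤s⁻¹ (≤-trans (≤-trans (≤-trans (m≤m+n 2 4) (m≤n+m 6 (6 * (U * U)))) a-large) a≤n)

    2np≤ : 2 * (n * p) ≤ μ U
    2np≤ = begin
      2 * (n * p)                        ≤⟨ *-monoʳ-≤ 2 (*-monoʳ-≤ n (n≤1+n p)) ⟩
      2 * (n * n)                        ≤⟨ *-monoʳ-≤ 2 n²≤ ⟩
      2 * ((U * U + 1) * (a * a))        ≡⟨ e (U * U) (a * a) ⟩
      μ U                                ∎
      where
      e : ∀ x y → 2 * ((x + 1) * y) ≡ (x + x + 2) * y
      e = solve-∀

    left≤p : (U ∸ 1) * a ≤ p
    left≤p = s≤s⁻¹ (begin
      suc ((U ∸ 1) * a)        ≡⟨ +-comm 1 _ ⟩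
      (U ∸ 1) * a + 1          ≤⟨ +-monoʳ-≤ ((U ∸ 1) * a) 1≤a ⟩
      (U ∸ 1) * a + a          ≡⟨ +-comm _ a ⟩
      suc (U ∸ 1) * a          ≡⟨ cong (_* a) (m+[n∸m]≡n 1≤U) ⟩
      U * a                    ≤⟨ Ua≤n ⟩
      n                        ∎)

    Θ-small : 2 * (C′ * (a * a)) + n ≤ n * n + (Z * a * (Z * a) + Z * a)
    Θ-small = begin
      2 * (C′ * (a * a)) + n                         ≤⟨ +-monoʳ-≤ _ n≤a² ⟩
      2 * (C′ * (a * a)) + a * a                     ≡⟨ e₁ C′ (a * a) ⟩
      (2 * C′ + 1) * (a * a)                         ≤⟨ *-monoˡ-≤ (a * a) C′-small ⟩
      (U * U + Z * Z) * (a * a)                      ≡⟨ e₂ U Z a ⟩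
      U * U * (a * a) + Z * a * (Z * a)              ≤⟨ +-mono-≤ U²a²≤n² (m≤m+n _ (Z * a)) ⟩
      n * n + (Z * a * (Z * a) + Z * a)              ∎
      where
      e₁ : ∀ C x → 2 * (C * x) + x ≡ (2 * C + 1) * x
      e₁ = solve-∀
      e₂ : ∀ U Z a → (U * U + Z * Z) * (a * a) ≡ U * U * (a * a) + Z * a * (Z * a)
      e₂ = solve-∀

    ρ-small : 2 * (P * (a * a)) + n ≤ n * n
    ρ-small = begin
      2 * (P * (a * a)) + n          ≤⟨ +-monoʳ-≤ _ n≤a² ⟩
      2 * (P * (a * a)) + a * a      ≡⟨ e P (a * a) ⟩
      (2 * P + 1) * (a * a)          ≤⟨ *-monoˡ-≤ (a * a) P-small ⟩
      U * U * (a * a)                ≤⟨ U²a²≤n² ⟩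
      n * n                          ∎
      where
      e : ∀ C x → 2 * (C * x) + x ≡ (2 * C + 1) * x
      e = solve-∀

    open Lower.Play p (C′ * (a * a)) (Z * a) (≤-trans (*-monoˡ-≤ a Z≤U) Ua≤n) Θ-small using (lower-bound)

    instance
      a²≢0 : NonZero (a * a)
      a²≢0 = >-nonZero (*-mono-≤ 1≤a 1≤a)

    above : ∀ t → C′ * (a * a) ≤ t → x₁ * (n * n) < y * t
    above t le = begin-strict
      x₁ * (n * n)                           ≤⟨ *-monoʳ-≤ x₁ n²≤ ⟩
      x₁ * ((U * U + 1) * (a * a))           ≡⟨ *-assoc x₁ (U * U + 1) (a * a) ⟨
      x₁ * (U * U + 1) * (a * a)             <⟨ *-monoˡ-< (a * a) C′-large ⟩
      y * C′ * (a * a)                       ≡⟨ *-assoc y C′ (a * a) ⟩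
      y * (C′ * (a * a))                     ≤⟨ *-monoʳ-≤ y le ⟩
      y * t                                  ∎

    below : ∀ t → t ≤ C * (a * a) → y * t < x₂ * (n * n)
    below t le = begin-strict
      y * t                                  ≤⟨ *-monoʳ-≤ y le ⟩
      y * (C * (a * a))                      ≡⟨ *-assoc y C (a * a) ⟨
      y * C * (a * a)                        <⟨ *-monoˡ-< (a * a) C-small ⟩
      x₂ * (U * U) * (a * a)                 ≡⟨ *-assoc x₂ (U * U) (a * a) ⟩
      x₂ * (U * U * (a * a))                 ≤⟨ *-monoʳ-≤ x₂ U²a²≤n² ⟩
      x₂ * (n * n)                           ∎

  eventually-bounded : .{{_ : NonZero U}} → Σ ℕ λ N → ∀ m → m ≥ N → Bounded m
  eventually-bounded = (6 * (U * U) + 6) * U , λ m m≥ → from m (subst (_≤ m / U) (m*n/n≡m _ U) (/-monoˡ-≤ U m≥))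
    where
    from : ∀ m → 6 * (U * U) + 6 ≤ m / U → Bounded m
    from zero    a-large = ⊥-elim (<⇒≱ (≤-trans (s≤s z≤n) (m≤n+m 6 (6 * (U * U)))) (≤-trans a-large (≤-reflexive (m<n⇒m/n≡0 (>-nonZero⁻¹ U)))))
    from (suc p) a-large = bounded p (suc p / U) (suc p % U)
      (trans (m≡m%n+[m/n]*n (suc p) U) (trans (+-comm (suc p % U) (suc p / U * U)) (cong (_+ suc p % U) (*-comm (suc p / U) U))))
      (<⇒≤ (m%n<n (suc p) U)) (>-nonZero⁻¹ U) a-large

theorem1p1 : Σ ℕ λ N → ∀ m → m ≥ N →
    (∃ λ t → Toppling.IsTopplingNumber (K m) t) ×
    (∀ t → Toppling.IsTopplingNumber (K m) t →
    (596400 * (m * m) < 1000000 * t) × (1000000 * t < 637152 * (m * m)))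
theorem1p1 = Bounds.eventually-bounded
  -- Here 175636 H = Z, and (1 - 1/50000) to the power 152370 is about 0.0475, the root t above. P
  -- is the initial deficit U²/2 rounded down; C is one below 0.637152 U², and C′ lies between
  -- 0.5964 U² and (U² + Z²)/2.
  1000000000000 2500000 439090000000 49999
  637151999999999999999999 596400010000000000000000 499999999999999999999999
  596400 637152 1000000 175636 152370
  _ _ (≤ᵇ⇒≤ _ _ _) (≤ᵇ⇒≤ _ _ _) (≤ᵇ⇒≤ _ _ _) (<ᵇ⇒< _ _ _) (<ᵇ⇒< _ _ _)
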